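{- For any integers $p,b\geq0$ the power series $\check M_p^{(b)}(\hat x_0,\hat x_1,\ldots)$ satisfies $D^{\mathrm{str}}\check M_p^{(b)}=0$ and $D^{\mathrm{dil}}\check M_p^{(b)}=-\check M_p^{(b)}$.
   Context: Define the formal power series in $r$ $$I(b,\ell;r)=\sum_{p=0}^\infty\frac{r^p}{(p!)^2}\prod_{m=0}^{p-1}(\ell^2-(b-m)^2),\qquad J(b;r)=\sum_{p=1}^\infty\frac{(-1)^{p+1}r^p}{p!(p-1)!}\prod_{m=0}^{p-2}(b-m)(b-m-1),$$ and $\check Z^{(b)}(r;\hat x_0,\hat x_1,\ldots)=J(b;r)-\sum_{\ell=0}^\infty I(b,\ell;r)\hat x_\ell$. $\check R^{(b)}(\hat x_0,\hat x_1,\ldots)$ is the unique formal power series with zero constant term satisfying $\check Z^{(b)}(\check R^{(b)};\hat x_0,\hat x_1,\ldots)=0$. For $p\geq0$ let $Q_p(b,j)$ be the unique polynomial with $$\sum_{k=b}^{j-1}\binom{2k+1+p}{2p+1}\binom{2j-1}{j+k}=\binom{2j-1}{j+b}Q_p(b,j)\quad\text{for all integers }j>b\geq0,$$ and define $$\check M_p^{(b)}(\hat x_0,\hat x_1,\ldots)=Q_p(b,(1+r)\,\partial_r)\,(1+r)^{ -b}\,\check Z^{(b)}(r;\hat x_0,\hat x_1,\ldots)\Big|_{r=\check R^{(b)}(\hat x_0,\hat x_1,\ldots)},$$ where $j$ in $Q_p(b,j)$ is replaced by the operator $(1+r)\partial_r$ acting on $(1+r)^{ -b}\check Z^{(b)}$.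 The operators are $$D^{\mathrm{str}}=\frac{\partial}{\partial\hat x_1}-\sum_{\ell=0}^\infty\hat x_\ell\left(-\ell\frac{\partial}{\partial\hat x_\ell}+\sum_{k=1}^\ell2k\frac{\partial}{\partial\hat x_k}-\sum_{k=1}^b2k\frac{\partial}{\partial\hat x_k}\right),\qquad D^{\mathrm{dil}}=\frac{\partial}{\partial\hat x_1}-\frac{\partial}{\partial\hat x_0}-\sum_{\ell=0}^\infty\hat x_\ell\frac{\partial}{\partial\hat x_\ell}.$$ -}

module Defs where

open import Data.Nat.Base as ℕ using (ℕ; zero; suc; _!)
open import Data.Nat.Properties using (_!≢0; _!*_!≢0)
open import Data.Nat.Combinatorics using (_C_)
open import Data.Nat.ListAction using () renaming (sum to degree)
open import Data.Integer.Base as ℤ using (ℤ; +_; 1ℤ; -1ℤ)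
import Data.Integer.Properties as ℤ
open import Data.Rational.Base as ℚ using (ℚ; 0ℚ; 1ℚ; _/_)
import Data.Rational.Properties as ℚ
open import Data.Fin.Base using (toℕ)
open import Data.List.Base using (List; []; _∷_; _∷ʳ_; length; map)
open import Data.Product.Base using (_×_)
open import Relation.Binary.PropositionalEquality
  using (_≡_; refl; sym; trans; cong; cong₂; module ≡-Reasoning)
open import Algebra.Properties.Monoid.Sum ℚ.+-0-monoid
  using (sum; sum-cong-≗)
open import Algebra.Definitions.RawMonoid ℤ.*-1-rawMonoid
  using () renaming (sum to product)

∑ : ℕ → (ℕ → ℚ) → ℚ
∑ n f = sum {n} (λ i → f (toℕ i))

syntax ∑ n (λ i → e) = ∑[ i < n ] e

∏ : ℕ → (ℕ → ℤ) → ℤ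
∏ n f = product {n} (λ i → f (toℕ i))

syntax ∏ n (λ i → e) = ∏[ i < n ] e

∑-cong : ∀ n {f g : ℕ → ℚ} → (∀ i → f i ≡ g i) → ∑ n f ≡ ∑ n g
∑-cong n f≗g = sum-cong-≗ {n} (λ i → f≗g (toℕ i))

fromℤ : ℤ → ℚ
fromℤ z = z / 1

fromℕ : ℕ → ℚ
fromℕ n = fromℤ (+ n)

-- a₀ ∷ a₁ ∷ … ∷ [] is x₀^a₀ x₁^a₁ ⋯, so lists that differ only by
-- trailing zeros are the same monomial.
Monomial : Set
Monomial = List ℕ

exponent : ℕ → Monomial → ℕ
exponent k       []      = 0
exponent zero    (a ∷ α) = a
exponent (suc k) (a ∷ α) = exponent k α

-- α ↦ x_k · α
raise : ℕ → Monomial → Monomial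
raise zero    []      = 1 ∷ []
raise zero    (a ∷ α) = suc a ∷ α
raise (suc k) []      = 0 ∷ raise k []
raise (suc k) (a ∷ α) = a ∷ raise k α

-- Arbitrary families of coefficients are allowed, infinitely many of
-- them nonzero in a given degree, e.g. Σ_ℓ x_ℓ.
Coefficients : Set
Coefficients = Monomial → ℚ

WellDefined : Coefficients → Set
WellDefined f = ∀ α → f (α ∷ʳ 0) ≡ f α

record FPS : Set where
  field
    coeff       : Coefficients
    wellDefined : WellDefined coeff

open FPS public

infix 4 _≈_

_≈_ : FPS → FPS → Set
F ≈ G = ∀ α → coeff F α ≡ coeff G α

constᶜ : ℚ → Coefficients
constᶜ c []          = c
constᶜ c (zero  ∷ α) = constᶜ c α
constᶜ c (suc _ ∷ α) = 0ℚ

constᶜ-wd : ∀ c → WellDefined (constᶜ c)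
constᶜ-wd c []          = refl
constᶜ-wd c (zero  ∷ α) = constᶜ-wd c α
constᶜ-wd c (suc _ ∷ α) = refl

const : ℚ → FPS
const c = record { coeff = constᶜ c ; wellDefined = constᶜ-wd c }

0# 1# : FPS
0# = const 0ℚ
1# = const 1ℚ

infixl 6 _+_ _-_
infixl 7 _*_ _•_
infix  8 -_
infixr 8 _^_

_+_ : FPS → FPS → FPS
F + G = record
  { coeff       = λ α → coeff F α ℚ.+ coeff G α
  ; wellDefined = λ α → cong₂ ℚ._+_ (wellDefined F α) (wellDefined G α)
  }

-_ : FPS → FPS
- F = record
  { coeff       = λ α → ℚ.- coeff F α
  ; wellDefined = λ α → cong ℚ.-_ (wellDefined F α)
  }

_-_ : FPS → FPS → FPS
F - G = F + - G

_•_ : ℚ → FPS → FPS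
c • F = record
  { coeff       = λ α → c ℚ.* coeff F α
  ; wellDefined = λ α → cong (c ℚ.*_) (wellDefined F α)
  }

∑₁ : ℕ → (ℕ → FPS) → FPS
∑₁ n F = record
  { coeff       = λ α → ∑[ i < n ] coeff (F (suc i)) α
  ; wellDefined = λ α → ∑-cong n (λ i → wellDefined (F (suc i)) α)
  }

-- The coefficient of α in the Cauchy product is the sum of f β · g γ
-- over all βγ = α; the exponents are split one variable at a time.
mulᶜ : Coefficients → Coefficients → Coefficients
mulᶜ f g []      = f [] ℚ.* g []
mulᶜ f g (a ∷ α) =
  ∑[ i < suc a ] mulᶜ (λ β → f (i ∷ β)) (λ γ → g (a ℕ.∸ i ∷ γ)) α

mulᶜ-wd : ∀ {f g} → WellDefined f → WellDefined g → WellDefined (mulᶜ f g)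
mulᶜ-wd f-wd g-wd []      =
  trans (ℚ.+-identityʳ _) (cong₂ ℚ._*_ (f-wd []) (g-wd []))
mulᶜ-wd f-wd g-wd (a ∷ α) = ∑-cong (suc a) λ i →
  mulᶜ-wd (λ β → f-wd (i ∷ β)) (λ γ → g-wd (a ℕ.∸ i ∷ γ)) α

_*_ : FPS → FPS → FPS
F * G = record
  { coeff       = mulᶜ (coeff F) (coeff G)
  ; wellDefined = mulᶜ-wd (wellDefined F) (wellDefined G)
  }

_^_ : FPS → ℕ → FPS
F ^ zero  = 1#
F ^ suc n = F * F ^ n

exponent-∷ʳ0 : ∀ k α → exponent k (α ∷ʳ 0) ≡ exponent k α
exponent-∷ʳ0 zero    []      = refl
exponent-∷ʳ0 (suc k) []      = refl
exponent-∷ʳ0 zero    (a ∷ α) = refl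
exponent-∷ʳ0 (suc k) (a ∷ α) = exponent-∷ʳ0 k α

raise-wd : ∀ k {f} → WellDefined f → WellDefined (λ α → f (raise k α))
raise-wd zero    f-wd []      = refl
raise-wd (suc k) f-wd []      = refl
raise-wd zero    f-wd (a ∷ α) = f-wd (suc a ∷ α)
raise-wd (suc k) f-wd (a ∷ α) = raise-wd k (λ β → f-wd (a ∷ β)) α

∂ : ℕ → FPS → FPS
∂ k F = record
  { coeff       = λ α → fromℕ (suc (exponent k α)) ℚ.* coeff F (raise k α)
  ; wellDefined = λ α → cong₂ (λ e c → fromℕ (suc e) ℚ.* c)
                              (exponent-∷ʳ0 k α)
                              (raise-wd k (wellDefined F) α)
  }

x·ᶜ : ℕ → Coefficients → Coefficients
x·ᶜ ℓ       f []          = 0ℚ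
x·ᶜ zero    f (zero  ∷ α) = 0ℚ
x·ᶜ zero    f (suc a ∷ α) = f (a ∷ α)
x·ᶜ (suc ℓ) f (a     ∷ α) = x·ᶜ ℓ (λ β → f (a ∷ β)) α

x·ᶜ-wd : ∀ ℓ {f} → WellDefined f → WellDefined (x·ᶜ ℓ f)
x·ᶜ-wd zero    f-wd []          = refl
x·ᶜ-wd (suc ℓ) f-wd []          = refl
x·ᶜ-wd zero    f-wd (zero  ∷ α) = refl
x·ᶜ-wd zero    f-wd (suc a ∷ α) = f-wd (a ∷ α)
x·ᶜ-wd (suc ℓ) f-wd (a     ∷ α) = x·ᶜ-wd ℓ (λ β → f-wd (a ∷ β)) α

-- The infinite sum Σ_{ℓ≥0} x_ℓ F_ℓ.  A monomial α involves only
-- variables x_ℓ with ℓ < length α, so the other summands do not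
-- contribute to the coefficient of α.
∑x·ᶜ : (ℕ → Coefficients) → Coefficients
∑x·ᶜ f α = ∑[ ℓ < length α ] x·ᶜ ℓ (f ℓ) α

∑x·ᶜ-wd : ∀ {f} → (∀ ℓ → WellDefined (f ℓ)) → WellDefined (∑x·ᶜ f)
∑x·ᶜ-wd f-wd []      = refl
∑x·ᶜ-wd f-wd (a ∷ α) = cong₂ ℚ._+_
  (x·ᶜ-wd zero (f-wd 0) (a ∷ α))
  (∑x·ᶜ-wd (λ ℓ β → f-wd (suc ℓ) (a ∷ β)) α)

∑x· : (ℕ → FPS) → FPS
∑x· F = record
  { coeff       = ∑x·ᶜ (λ ℓ → coeff (F ℓ))
  ; wellDefined = ∑x·ᶜ-wd (λ ℓ → wellDefined (F ℓ))
  }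

-- Series in r whose coefficients are series in x₀, x₁, …
FPS[[r]] : Set
FPS[[r]] = ℕ → FPS

∂ᵣ : FPS[[r]] → FPS[[r]]
∂ᵣ F n = fromℕ (suc n) • F (suc n)

[1+r]· : FPS[[r]] → FPS[[r]]
[1+r]· F zero    = F zero
[1+r]· F (suc n) = F (suc n) + F n

[1+r]⁻¹· : FPS[[r]] → FPS[[r]]
[1+r]⁻¹· F zero    = F zero
[1+r]⁻¹· F (suc n) = F (suc n) - [1+r]⁻¹· F n

[1+r]-inverse : ∀ F n → [1+r]· ([1+r]⁻¹· F) n ≈ F n
[1+r]-inverse F zero    α = refl
[1+r]-inverse F (suc n) α = begin
  (x ℚ.+ ℚ.- y) ℚ.+ y  ≡⟨ ℚ.+-assoc x (ℚ.- y) y ⟩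
  x ℚ.+ (ℚ.- y ℚ.+ y)  ≡⟨ cong (x ℚ.+_) (ℚ.+-inverseˡ y) ⟩
  x ℚ.+ 0ℚ             ≡⟨ ℚ.+-identityʳ x ⟩
  x                    ∎
  where
  open ≡-Reasoning
  x = coeff (F (suc n)) α
  y = coeff ([1+r]⁻¹· F n) α

[1+r]^-_· : ℕ → FPS[[r]] → FPS[[r]]
[1+r]^- zero  · F = F
[1+r]^- suc b · F = [1+r]⁻¹· ([1+r]^- b · F)

-- Substitution r = R, for R with zero constant term: every monomial of
-- Rⁿ then has degree at least n, so the coefficient of α in
-- Σ_n F_n Rⁿ only involves n ≤ degree α.

degree-∷ʳ0 : ∀ α → degree (α ∷ʳ 0) ≡ degree α
degree-∷ʳ0 []      = refl
degree-∷ʳ0 (a ∷ α) = cong (a ℕ.+_) (degree-∷ʳ0 α)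

infix 9 _∣r=_

_∣r=_ : FPS[[r]] → FPS → FPS
F ∣r= R = record
  { coeff       = λ α → ∑[ n < suc (degree α) ] coeff (F n * R ^ n) α
  ; wellDefined = λ α → trans
      (cong (λ d → ∑[ n < suc d ] coeff (F n * R ^ n) (α ∷ʳ 0)) (degree-∷ʳ0 α))
      (∑-cong (suc (degree α)) (λ n → wellDefined (F n * R ^ n) α))
  }

I : (b ℓ : ℕ) → ℕ → ℚ
I b ℓ p = (∏[ m < p ] (+ ℓ ℤ.* + ℓ ℤ.- (+ b ℤ.- + m) ℤ.* (+ b ℤ.- + m)))
        / (p ! ℕ.* p !)
  where instance _ = p !* p !≢0

J : (b : ℕ) → ℕ → ℚ
J b zero    = 0ℚ
J b (suc q) = (-1ℤ ℤ.^ (suc q ℕ.+ 1)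
                ℤ.* (∏[ m < q ] ((+ b ℤ.- + m) ℤ.* (+ b ℤ.- + m ℤ.- 1ℤ))))
            / (suc q ! ℕ.* q !)
  where instance _ = suc q !* q !≢0

Ž : (b : ℕ) → FPS[[r]]
Ž b n = const (J b n) - ∑x· (λ ℓ → const (I b ℓ n))

IsŘ : (b : ℕ) → FPS → Set
IsŘ b R = coeff R [] ≡ 0ℚ × Ž b ∣r= R ≈ 0#

-- Coefficient lists, lowest degree first.
Poly : Set
Poly = List ℚ

-- Polynomials in j whose coefficients are polynomials in b.
Poly₂ : Set
Poly₂ = List Poly

eval : Poly → ℚ → ℚ
eval []      x = 0ℚ
eval (c ∷ q) x = c ℚ.+ x ℚ.* eval q x

at : Poly₂ → ℚ → Poly
at Q b = map (λ q → eval q b) Q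

-- The sum over b ≤ k ≤ j - 1 is indexed by k = b + i.
IsQ : (p : ℕ) → Poly₂ → Set
IsQ p Q = ∀ b j → b ℕ.< j →
  (∑[ i < j ℕ.∸ b ] (let k = b ℕ.+ i in
     fromℕ ((2 ℕ.* k ℕ.+ 1 ℕ.+ p) C (2 ℕ.* p ℕ.+ 1))
       ℚ.* fromℕ ((2 ℕ.* j ℕ.∸ 1) C (j ℕ.+ k))))
  ≡ fromℕ ((2 ℕ.* j ℕ.∸ 1) C (j ℕ.+ b))
      ℚ.* eval (at Q (fromℕ b)) (fromℕ j)

evalOp : Poly → (FPS[[r]] → FPS[[r]]) → FPS[[r]] → FPS[[r]]
evalOp []      D F n = 0#
evalOp (c ∷ q) D F n = c • F n + evalOp q D (D F) n

M̌ : (Q : Poly₂) (b : ℕ) (R : FPS) → FPS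
M̌ Q b R =
  evalOp (at Q (fromℕ b)) (λ F → [1+r]· (∂ᵣ F)) ([1+r]^- b · (Ž b)) ∣r= R

Dstr : (b : ℕ) → FPS → FPS
Dstr b F = ∂ 1 F - ∑x· λ ℓ →
  - (fromℕ ℓ • ∂ ℓ F)
  + ∑₁ ℓ (λ k → fromℕ (2 ℕ.* k) • ∂ k F)
  - ∑₁ b (λ k → fromℕ (2 ℕ.* k) • ∂ k F)

Ddil : FPS → FPS
Ddil F = ∂ 1 F - ∂ 0 F - ∑x· (λ ℓ → ∂ ℓ F)

{-# OPTIONS --safe #-}
module Submission where

-- Put Θ = (1 + r)∂ᵣ.  Contiguity relations between the hypergeometric
-- series I(b, ℓ; r) give D Ž = s ΘŽ + c Ž, where (s, c) = (-1, b) for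
-- D = Dstr and (s, c) = (0, -1) for D = Ddil.  Passing to (1 + r)^-b Ž
-- replaces c by c + b s, and a relation of this form is preserved by every
-- polynomial in Θ, so H = Q(Θ) (1 + r)^-b Ž satisfies
-- D H = s ΘH + (c + b s) H.  Applying D to Ž(R) = 0 gives
-- D R = - s (1 + R), and then the chain rule gives
-- D (H(R)) = (c + b s) H(R), with c + b s = 0 for Dstr and -1 for Ddil.

open import Defs
open import Algebra.Bundles using (CommutativeRing)
import Algebra.Solver.Ring.NaturalCoefficients.Default
open import Data.Integer.Base as ℤ using (ℤ; +_; 1ℤ; -1ℤ)
import Data.Integer.Properties as ℤ
open import Data.List.Base using ([]; _∷_)
open import Data.Nat.Base as ℕ using (ℕ; zero; suc; _!; s≤s)
open import Data.Nat.ListAction using () renaming (sum to degree)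
import Data.Nat.Properties as ℕ
open import Data.Product.Base using (_×_; _,_; proj₁)
open import Data.Rational.Base as ℚ using (ℚ; 0ℚ; 1ℚ; _/_; toℚᵘ)
import Data.Rational.Properties as ℚ
open import Data.Rational.Unnormalised.Base as ℚᵘ using (mkℚᵘ; *≡*)
import Data.Rational.Unnormalised.Properties as ℚᵘ
open import Function.Base using (flip; _∘_)
open import Relation.Binary.PropositionalEquality
  using (_≡_; refl; sym; trans; cong; cong₂; subst; module ≡-Reasoning)
open import Relation.Nullary.Decidable.Core using (dec⇒maybe)
open import Tactic.RingSolver using (solve-∀)
open import Tactic.RingSolver.Core.AlmostCommutativeRing
  using (AlmostCommutativeRing; fromCommutativeRing)

-- Rational arithmetic

ℚ-ring : AlmostCommutativeRing _ _
ℚ-ring = fromCommutativeRing ℚ.+-*-commutativeRing (λ x → dec⇒maybe (0ℚ ℚ.≟ x))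

toℚᵘ-/ : ∀ z d .{{_ : ℕ.NonZero d}} → toℚᵘ (z / d) ℚᵘ.≃ (z ℚᵘ./ d)
toℚᵘ-/ z (suc d) = ℚ.toℚᵘ-fromℚᵘ (mkℚᵘ z d)

fromℤ-+ : ∀ x y → fromℤ (x ℤ.+ y) ≡ fromℤ x ℚ.+ fromℤ y
fromℤ-+ x y = ℚ.toℚᵘ-injective (begin
  toℚᵘ (fromℤ (x ℤ.+ y))                ≈⟨ toℚᵘ-/ (x ℤ.+ y) 1 ⟩
  (x ℤ.+ y) ℚᵘ./ 1                      ≈⟨ *≡* (cong (ℤ._* 1ℤ) (cong₂ ℤ._+_ (sym (ℤ.*-identityʳ x)) (sym (ℤ.*-identityʳ y)))) ⟩
  (x ℚᵘ./ 1) ℚᵘ.+ (y ℚᵘ./ 1)            ≈⟨ ℚᵘ.+-cong (toℚᵘ-/ x 1) (toℚᵘ-/ y 1) ⟨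
  toℚᵘ (fromℤ x) ℚᵘ.+ toℚᵘ (fromℤ y)    ≈⟨ ℚ.toℚᵘ-homo-+ (fromℤ x) (fromℤ y) ⟨
  toℚᵘ (fromℤ x ℚ.+ fromℤ y)            ∎)
  where open ℚᵘ.≃-Reasoning

fromℤ-* : ∀ x y → fromℤ (x ℤ.* y) ≡ fromℤ x ℚ.* fromℤ y
fromℤ-* x y = ℚ.toℚᵘ-injective (begin
  toℚᵘ (fromℤ (x ℤ.* y))                ≈⟨ toℚᵘ-/ (x ℤ.* y) 1 ⟩
  (x ℚᵘ./ 1) ℚᵘ.* (y ℚᵘ./ 1)            ≈⟨ ℚᵘ.*-cong (toℚᵘ-/ x 1) (toℚᵘ-/ y 1) ⟨
  toℚᵘ (fromℤ x) ℚᵘ.* toℚᵘ (fromℤ y)    ≈⟨ ℚ.toℚᵘ-homo-* (fromℤ x) (fromℤ y) ⟨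
  toℚᵘ (fromℤ x ℚ.* fromℤ y)            ∎)
  where open ℚᵘ.≃-Reasoning

fromℤ-neg : ∀ x → fromℤ (ℤ.- x) ≡ ℚ.- fromℤ x
fromℤ-neg x = ℚ.toℚᵘ-injective (begin
  toℚᵘ (fromℤ (ℤ.- x))   ≈⟨ toℚᵘ-/ (ℤ.- x) 1 ⟩
  ℚᵘ.- (x ℚᵘ./ 1)        ≈⟨ ℚᵘ.-‿cong (toℚᵘ-/ x 1) ⟨
  ℚᵘ.- toℚᵘ (fromℤ x)    ≈⟨ ℚ.toℚᵘ-homo‿- (fromℤ x) ⟨
  toℚᵘ (ℚ.- fromℤ x)     ∎)
  where open ℚᵘ.≃-Reasoning

fromℤ-- : ∀ x y → fromℤ (x ℤ.- y) ≡ fromℤ x ℚ.- fromℤ y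
fromℤ-- x y = trans (fromℤ-+ x (ℤ.- y)) (cong (fromℤ x ℚ.+_) (fromℤ-neg y))

fromℕ-suc : ∀ n → fromℕ (suc n) ≡ 1ℚ ℚ.+ fromℕ n
fromℕ-suc n = fromℤ-+ 1ℤ (+ n)

fromℕ-+ : ∀ m n → fromℕ (m ℕ.+ n) ≡ fromℕ m ℚ.+ fromℕ n
fromℕ-+ m n = fromℤ-+ (+ m) (+ n)

fromℕ-* : ∀ m n → fromℕ (m ℕ.* n) ≡ fromℕ m ℚ.* fromℕ n
fromℕ-* m n = trans (cong fromℤ (ℤ.pos-* m n)) (fromℤ-* (+ m) (+ n))

/-*-cancel : ∀ z d .{{_ : ℕ.NonZero d}} → (z / d) ℚ.* fromℕ d ≡ fromℤ z
/-*-cancel z d@(suc d-1) = ℚ.toℚᵘ-injective (begin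
  toℚᵘ ((z / d) ℚ.* fromℕ d)            ≈⟨ ℚ.toℚᵘ-homo-* (z / d) (fromℕ d) ⟩
  toℚᵘ (z / d) ℚᵘ.* toℚᵘ (fromℕ d)      ≈⟨ ℚᵘ.*-cong (toℚᵘ-/ z d) (toℚᵘ-/ (+ d) 1) ⟩
  (z ℚᵘ./ d) ℚᵘ.* ((+ d) ℚᵘ./ 1)        ≈⟨ *≡* (trans (ℤ.*-identityʳ (z ℤ.* + d)) (cong (λ n → z ℤ.* + n) (sym (ℕ.*-identityʳ d)))) ⟩
  z ℚᵘ./ 1                              ≈⟨ toℚᵘ-/ z 1 ⟨
  toℚᵘ (fromℤ z)                        ∎)
  where open ℚᵘ.≃-Reasoning

fromℕ-cancel : ∀ d .{{_ : ℕ.NonZero d}} {x y} → x ℚ.* fromℕ d ≡ y ℚ.* fromℕ d → x ≡ y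
fromℕ-cancel d {x} {y} eq = begin
  x                              ≡⟨ expand x ⟩
  x ℚ.* fromℕ d ℚ.* (1ℤ / d)     ≡⟨ cong (ℚ._* (1ℤ / d)) eq ⟩
  y ℚ.* fromℕ d ℚ.* (1ℤ / d)     ≡⟨ expand y ⟨
  y                              ∎
  where
  open ≡-Reasoning
  rearrange : ∀ z i e → z ℚ.* e ℚ.* i ≡ z ℚ.* (i ℚ.* e)
  rearrange = solve-∀ ℚ-ring
  expand : ∀ z → z ≡ z ℚ.* fromℕ d ℚ.* (1ℤ / d)
  expand z = sym (trans (rearrange z (1ℤ / d) (fromℕ d))
                 (trans (cong (z ℚ.*_) (/-*-cancel 1ℤ d)) (ℚ.*-identityʳ z)))

∏-last : ∀ n f → ∏ (suc n) f ≡ ∏ n f ℤ.* f n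
∏-last zero    f = trans (ℤ.*-identityʳ (f 0)) (sym (ℤ.*-identityˡ (f 0)))
∏-last (suc n) f = trans (cong (f 0 ℤ.*_) (∏-last n (λ i → f (suc i))))
                         (sym (ℤ.*-assoc (f 0) _ _))

I-step : ∀ b ℓ n → let L = fromℕ ℓ; B = fromℕ b; N = fromℕ n in
  fromℕ (suc n) ℚ.* fromℕ (suc n) ℚ.* I b ℓ (suc n)
  ≡ I b ℓ n ℚ.* ((L ℚ.- B ℚ.+ N) ℚ.* (L ℚ.+ B ℚ.- N))
I-step b ℓ n = fromℕ-cancel (n ! ℕ.* n !) (begin
  M ℚ.* M ℚ.* I b ℓ (suc n) ℚ.* fromℕ (n ! ℕ.* n !)
    ≡⟨ cong (M ℚ.* M ℚ.* I b ℓ (suc n) ℚ.*_) (fromℕ-* (n !) (n !)) ⟩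
  M ℚ.* M ℚ.* I b ℓ (suc n) ℚ.* (F ℚ.* F)                ≡⟨ rearr₁ M (I b ℓ (suc n)) F ⟩
  I b ℓ (suc n) ℚ.* ((M ℚ.* F) ℚ.* (M ℚ.* F))
    ≡⟨ cong (λ x → I b ℓ (suc n) ℚ.* (x ℚ.* x)) (fromℕ-* (suc n) (n !)) ⟨
  I b ℓ (suc n) ℚ.* (fromℕ (suc n !) ℚ.* fromℕ (suc n !))
    ≡⟨ cong (I b ℓ (suc n) ℚ.*_) (fromℕ-* (suc n !) (suc n !)) ⟨
  I b ℓ (suc n) ℚ.* fromℕ (suc n ! ℕ.* suc n !)
    ≡⟨ /-*-cancel (∏ (suc n) f) (suc n ! ℕ.* suc n !) ⟩
  fromℤ (∏ (suc n) f)                                    ≡⟨ cong fromℤ (∏-last n f) ⟩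
  fromℤ (∏ n f ℤ.* f n)                                  ≡⟨ fromℤ-* (∏ n f) (f n) ⟩
  fromℤ (∏ n f) ℚ.* fromℤ (f n)
    ≡⟨ cong₂ ℚ._*_ (sym (/-*-cancel (∏ n f) (n ! ℕ.* n !))) f-factors ⟩
  I b ℓ n ℚ.* fromℕ (n ! ℕ.* n !) ℚ.* _
    ≡⟨ rearr₂ (I b ℓ n) (fromℕ (n ! ℕ.* n !)) _ ⟩
  I b ℓ n ℚ.* ((L ℚ.- B ℚ.+ N) ℚ.* (L ℚ.+ B ℚ.- N)) ℚ.* fromℕ (n ! ℕ.* n !) ∎)
  where
  open ≡-Reasoning
  instance
    n!² : ℕ.NonZero (n ! ℕ.* n !)
    n!² = ℕ._!*_!≢0 n n
    [1+n]!² : ℕ.NonZero (suc n ! ℕ.* suc n !)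
    [1+n]!² = ℕ._!*_!≢0 (suc n) (suc n)
  L = fromℕ ℓ
  B = fromℕ b
  N = fromℕ n
  M = fromℕ (suc n)
  F = fromℕ (n !)
  f : ℕ → ℤ
  f m = + ℓ ℤ.* + ℓ ℤ.- (+ b ℤ.- + m) ℤ.* (+ b ℤ.- + m)
  rearr₁ : ∀ m x g → m ℚ.* m ℚ.* x ℚ.* (g ℚ.* g) ≡ x ℚ.* ((m ℚ.* g) ℚ.* (m ℚ.* g))
  rearr₁ = solve-∀ ℚ-ring
  rearr₂ : ∀ x d y → x ℚ.* d ℚ.* y ≡ x ℚ.* y ℚ.* d
  rearr₂ = solve-∀ ℚ-ring
  square-difference : ∀ l c m → l ℚ.* l ℚ.- (c ℚ.- m) ℚ.* (c ℚ.- m) ≡ (l ℚ.- c ℚ.+ m) ℚ.* (l ℚ.+ c ℚ.- m)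
  square-difference = solve-∀ ℚ-ring
  f-factors : fromℤ (f n) ≡ (L ℚ.- B ℚ.+ N) ℚ.* (L ℚ.+ B ℚ.- N)
  f-factors = begin
    fromℤ (f n)                                              ≡⟨ fromℤ-- (+ ℓ ℤ.* + ℓ) _ ⟩
    fromℤ (+ ℓ ℤ.* + ℓ) ℚ.- fromℤ ((+ b ℤ.- + n) ℤ.* (+ b ℤ.- + n))
      ≡⟨ cong₂ ℚ._-_ (fromℤ-* (+ ℓ) (+ ℓ)) (fromℤ-* (+ b ℤ.- + n) (+ b ℤ.- + n)) ⟩
    L ℚ.* L ℚ.- fromℤ (+ b ℤ.- + n) ℚ.* fromℤ (+ b ℤ.- + n)
      ≡⟨ cong (λ x → L ℚ.* L ℚ.- x ℚ.* x) (fromℤ-- (+ b) (+ n)) ⟩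
    L ℚ.* L ℚ.- (B ℚ.- N) ℚ.* (B ℚ.- N)                      ≡⟨ square-difference L B N ⟩
    (L ℚ.- B ℚ.+ N) ℚ.* (L ℚ.+ B ℚ.- N)                      ∎

J-step : ∀ b n → let B = fromℕ b; N = fromℕ n in
  fromℕ (suc (suc n)) ℚ.* fromℕ (suc n) ℚ.* J b (suc (suc n))
  ≡ ℚ.- (J b (suc n) ℚ.* ((B ℚ.- N) ℚ.* (B ℚ.- N ℚ.- 1ℚ)))
J-step b n = fromℕ-cancel (suc n ! ℕ.* n !) (begin
  M₂ ℚ.* M₁ ℚ.* x ℚ.* fromℕ (suc n ! ℕ.* n !)
    ≡⟨ cong (M₂ ℚ.* M₁ ℚ.* x ℚ.*_) (fromℕ-* (suc n !) (n !)) ⟩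
  M₂ ℚ.* M₁ ℚ.* x ℚ.* (fromℕ (suc n !) ℚ.* fromℕ (n !))
    ≡⟨ rearr₁ M₂ M₁ x (fromℕ (suc n !)) (fromℕ (n !)) ⟩
  x ℚ.* ((M₂ ℚ.* fromℕ (suc n !)) ℚ.* (M₁ ℚ.* fromℕ (n !)))
    ≡⟨ cong (x ℚ.*_) (cong₂ ℚ._*_ (fromℕ-* (suc (suc n)) (suc n !)) (fromℕ-* (suc n) (n !))) ⟨
  x ℚ.* (fromℕ (suc (suc n) !) ℚ.* fromℕ (suc n !))
    ≡⟨ cong (x ℚ.*_) (fromℕ-* (suc (suc n) !) (suc n !)) ⟨
  x ℚ.* fromℕ (suc (suc n) ! ℕ.* suc n !)
    ≡⟨ /-*-cancel (-1ℤ ℤ.* s ℤ.* ∏ (suc n) f) (suc (suc n) ! ℕ.* suc n !) ⟩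
  fromℤ (-1ℤ ℤ.* s ℤ.* ∏ (suc n) f)
    ≡⟨ cong fromℤ (trans (cong (-1ℤ ℤ.* s ℤ.*_) (∏-last n f)) (regroup s (∏ n f) (f n))) ⟩
  fromℤ (-1ℤ ℤ.* (s ℤ.* ∏ n f ℤ.* f n))                      ≡⟨ fromℤ-* -1ℤ (s ℤ.* ∏ n f ℤ.* f n) ⟩
  (ℚ.- 1ℚ) ℚ.* fromℤ (s ℤ.* ∏ n f ℤ.* f n)
    ≡⟨ cong ((ℚ.- 1ℚ) ℚ.*_) (fromℤ-* (s ℤ.* ∏ n f) (f n)) ⟩
  (ℚ.- 1ℚ) ℚ.* (fromℤ (s ℤ.* ∏ n f) ℚ.* fromℤ (f n))
    ≡⟨ cong ((ℚ.- 1ℚ) ℚ.*_) (cong₂ ℚ._*_ (sym (/-*-cancel (s ℤ.* ∏ n f) (suc n ! ℕ.* n !))) f-value) ⟩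
  (ℚ.- 1ℚ) ℚ.* (y ℚ.* d ℚ.* g)                               ≡⟨ rearr₂ y d g ⟩
  ℚ.- (y ℚ.* g) ℚ.* d                                        ∎)
  where
  open ≡-Reasoning
  instance
    nz₁ : ℕ.NonZero (suc n ! ℕ.* n !)
    nz₁ = ℕ._!*_!≢0 (suc n) n
    nz₂ : ℕ.NonZero (suc (suc n) ! ℕ.* suc n !)
    nz₂ = ℕ._!*_!≢0 (suc (suc n)) (suc n)
  B = fromℕ b
  N = fromℕ n
  M₁ = fromℕ (suc n)
  M₂ = fromℕ (suc (suc n))
  x = J b (suc (suc n))
  y = J b (suc n)
  d = fromℕ (suc n ! ℕ.* n !)
  g = (B ℚ.- N) ℚ.* (B ℚ.- N ℚ.- 1ℚ)
  s = -1ℤ ℤ.^ (suc n ℕ.+ 1)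
  f : ℕ → ℤ
  f m = (+ b ℤ.- + m) ℤ.* (+ b ℤ.- + m ℤ.- 1ℤ)
  regroup : ∀ s p q → -1ℤ ℤ.* s ℤ.* (p ℤ.* q) ≡ -1ℤ ℤ.* (s ℤ.* p ℤ.* q)
  regroup s p q = trans (ℤ.*-assoc -1ℤ s (p ℤ.* q)) (cong (-1ℤ ℤ.*_) (sym (ℤ.*-assoc s p q)))
  rearr₁ : ∀ m₂ m₁ x p q → m₂ ℚ.* m₁ ℚ.* x ℚ.* (p ℚ.* q) ≡ x ℚ.* ((m₂ ℚ.* p) ℚ.* (m₁ ℚ.* q))
  rearr₁ = solve-∀ ℚ-ring
  rearr₂ : ∀ y d g → (ℚ.- 1ℚ) ℚ.* (y ℚ.* d ℚ.* g) ≡ ℚ.- (y ℚ.* g) ℚ.* d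
  rearr₂ = solve-∀ ℚ-ring
  f-value : fromℤ (f n) ≡ g
  f-value = begin
    fromℤ (f n)                                        ≡⟨ fromℤ-* (+ b ℤ.- + n) _ ⟩
    fromℤ (+ b ℤ.- + n) ℚ.* fromℤ (+ b ℤ.- + n ℤ.- 1ℤ)
      ≡⟨ cong (fromℤ (+ b ℤ.- + n) ℚ.*_) (fromℤ-- (+ b ℤ.- + n) 1ℤ) ⟩
    fromℤ (+ b ℤ.- + n) ℚ.* (fromℤ (+ b ℤ.- + n) ℚ.- 1ℚ)
      ≡⟨ cong (λ x → x ℚ.* (x ℚ.- 1ℚ)) (fromℤ-- (+ b) (+ n)) ⟩
    g                                                  ∎

-- Contiguity relations

fromℕ-cancel-* : ∀ m n {x y} →
  fromℕ (suc m) ℚ.* fromℕ (suc n) ℚ.* x ≡ fromℕ (suc m) ℚ.* fromℕ (suc n) ℚ.* y → x ≡ y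
fromℕ-cancel-* m n {x} {y} eq = fromℕ-cancel (suc m ℕ.* suc n) (trans (move x) (trans eq (sym (move y))))
  where
  move : ∀ z → z ℚ.* fromℕ (suc m ℕ.* suc n) ≡ fromℕ (suc m) ℚ.* fromℕ (suc n) ℚ.* z
  move z = trans (cong (z ℚ.*_) (fromℕ-* (suc m) (suc n))) (ℚ.*-comm z _)

-- The factor common to I b ℓ (suc n) and I b (suc ℓ) (suc n).
S : (b ℓ : ℕ) → ℕ → ℚ
S b ℓ zero    = 1ℚ
S b ℓ (suc n) = S b ℓ n ℚ.* ((fromℕ ℓ ℚ.- fromℕ b ℚ.+ fromℕ (suc n)) ℚ.* (fromℕ ℓ ℚ.+ fromℕ b ℚ.- fromℕ n))
                ℚ.* (1ℤ / (suc (suc n) ℕ.* suc (suc n)))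

S-step : ∀ b ℓ n →
  fromℕ (suc (suc n)) ℚ.* fromℕ (suc (suc n)) ℚ.* S b ℓ (suc n)
  ≡ S b ℓ n ℚ.* ((fromℕ ℓ ℚ.- fromℕ b ℚ.+ fromℕ (suc n)) ℚ.* (fromℕ ℓ ℚ.+ fromℕ b ℚ.- fromℕ n))
S-step b ℓ n = begin
  M ℚ.* M ℚ.* (x ℚ.* i)
    ≡⟨ cong (ℚ._* (x ℚ.* i)) (fromℕ-* (suc (suc n)) (suc (suc n))) ⟨
  d ℚ.* (x ℚ.* i)                    ≡⟨ rearr d x i ⟩
  x ℚ.* (i ℚ.* d)
    ≡⟨ cong (x ℚ.*_) (/-*-cancel 1ℤ (suc (suc n) ℕ.* suc (suc n))) ⟩
  x ℚ.* 1ℚ                           ≡⟨ ℚ.*-identityʳ x ⟩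
  x                                  ∎
  where
  open ≡-Reasoning
  M = fromℕ (suc (suc n))
  d = fromℕ (suc (suc n) ℕ.* suc (suc n))
  i = 1ℤ / (suc (suc n) ℕ.* suc (suc n))
  x = S b ℓ n ℚ.* ((fromℕ ℓ ℚ.- fromℕ b ℚ.+ fromℕ (suc n)) ℚ.* (fromℕ ℓ ℚ.+ fromℕ b ℚ.- fromℕ n))
  rearr : ∀ d x i → d ℚ.* (x ℚ.* i) ≡ x ℚ.* (i ℚ.* d)
  rearr = solve-∀ ℚ-ring

I-via-S : ∀ b ℓ n →
  I b ℓ (suc n) ≡ (fromℕ ℓ ℚ.- fromℕ b) ℚ.* (fromℕ ℓ ℚ.+ fromℕ b ℚ.- fromℕ n) ℚ.* S b ℓ n
I-via-S b ℓ zero = begin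
  I b ℓ 1                  ≡⟨ ℚ.*-identityˡ (I b ℓ 1) ⟨
  1ℚ ℚ.* 1ℚ ℚ.* I b ℓ 1    ≡⟨ I-step b ℓ 0 ⟩
  1ℚ ℚ.* ((L ℚ.- B ℚ.+ 0ℚ) ℚ.* (L ℚ.+ B ℚ.- 0ℚ)) ≡⟨ alg L B ⟩
  (L ℚ.- B) ℚ.* (L ℚ.+ B ℚ.- 0ℚ) ℚ.* 1ℚ  ∎
  where
  open ≡-Reasoning
  L = fromℕ ℓ
  B = fromℕ b
  alg : ∀ l c → 1ℚ ℚ.* ((l ℚ.- c ℚ.+ 0ℚ) ℚ.* (l ℚ.+ c ℚ.- 0ℚ)) ≡ (l ℚ.- c) ℚ.* (l ℚ.+ c ℚ.- 0ℚ) ℚ.* 1ℚ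
  alg = solve-∀ ℚ-ring
I-via-S b ℓ (suc n) = fromℕ-cancel-* (suc n) (suc n) (begin
  M₂ ℚ.* M₂ ℚ.* I b ℓ (suc (suc n))
    ≡⟨ I-step b ℓ (suc n) ⟩
  I b ℓ (suc n) ℚ.* ((L ℚ.- B ℚ.+ M₁) ℚ.* (L ℚ.+ B ℚ.- M₁))
    ≡⟨ cong (ℚ._* ((L ℚ.- B ℚ.+ M₁) ℚ.* (L ℚ.+ B ℚ.- M₁))) (I-via-S b ℓ n) ⟩
  (L ℚ.- B) ℚ.* (L ℚ.+ B ℚ.- N) ℚ.* S b ℓ n ℚ.* ((L ℚ.- B ℚ.+ M₁) ℚ.* (L ℚ.+ B ℚ.- M₁))
    ≡⟨ alg₁ L B N M₁ (S b ℓ n) ⟩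
  (L ℚ.- B) ℚ.* (L ℚ.+ B ℚ.- M₁) ℚ.* (S b ℓ n ℚ.* ((L ℚ.- B ℚ.+ M₁) ℚ.* (L ℚ.+ B ℚ.- N)))
    ≡⟨ cong ((L ℚ.- B) ℚ.* (L ℚ.+ B ℚ.- M₁) ℚ.*_) (S-step b ℓ n) ⟨
  (L ℚ.- B) ℚ.* (L ℚ.+ B ℚ.- M₁) ℚ.* (M₂ ℚ.* M₂ ℚ.* S b ℓ (suc n))
    ≡⟨ alg₂ ((L ℚ.- B) ℚ.* (L ℚ.+ B ℚ.- M₁)) (M₂ ℚ.* M₂) (S b ℓ (suc n)) ⟩
  M₂ ℚ.* M₂ ℚ.* ((L ℚ.- B) ℚ.* (L ℚ.+ B ℚ.- M₁) ℚ.* S b ℓ (suc n))             ∎)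
  where
  open ≡-Reasoning
  L = fromℕ ℓ
  B = fromℕ b
  N = fromℕ n
  M₁ = fromℕ (suc n)
  M₂ = fromℕ (suc (suc n))
  alg₁ : ∀ l c n m s → (l ℚ.- c) ℚ.* (l ℚ.+ c ℚ.- n) ℚ.* s ℚ.* ((l ℚ.- c ℚ.+ m) ℚ.* (l ℚ.+ c ℚ.- m))
       ≡ (l ℚ.- c) ℚ.* (l ℚ.+ c ℚ.- m) ℚ.* (s ℚ.* ((l ℚ.- c ℚ.+ m) ℚ.* (l ℚ.+ c ℚ.- n)))
  alg₁ = solve-∀ ℚ-ring
  alg₂ : ∀ x y z → x ℚ.* (y ℚ.* z) ≡ y ℚ.* (x ℚ.* z)
  alg₂ = solve-∀ ℚ-ring

I-suc-via-S : ∀ b ℓ n →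
  I b (suc ℓ) (suc n) ≡ (fromℕ ℓ ℚ.- fromℕ b ℚ.+ fromℕ (suc n)) ℚ.* (fromℕ ℓ ℚ.+ fromℕ b ℚ.+ 1ℚ) ℚ.* S b ℓ n
I-suc-via-S b ℓ zero = begin
  I b (suc ℓ) 1                  ≡⟨ ℚ.*-identityˡ (I b (suc ℓ) 1) ⟨
  1ℚ ℚ.* 1ℚ ℚ.* I b (suc ℓ) 1    ≡⟨ I-step b (suc ℓ) 0 ⟩
  1ℚ ℚ.* ((L′ ℚ.- B ℚ.+ 0ℚ) ℚ.* (L′ ℚ.+ B ℚ.- 0ℚ))
    ≡⟨ cong (λ l → 1ℚ ℚ.* ((l ℚ.- B ℚ.+ 0ℚ) ℚ.* (l ℚ.+ B ℚ.- 0ℚ))) (fromℕ-suc ℓ) ⟩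
  1ℚ ℚ.* ((1ℚ ℚ.+ L ℚ.- B ℚ.+ 0ℚ) ℚ.* (1ℚ ℚ.+ L ℚ.+ B ℚ.- 0ℚ)) ≡⟨ alg L B ⟩
  (L ℚ.- B ℚ.+ 1ℚ) ℚ.* (L ℚ.+ B ℚ.+ 1ℚ) ℚ.* 1ℚ  ∎
  where
  open ≡-Reasoning
  L = fromℕ ℓ
  L′ = fromℕ (suc ℓ)
  B = fromℕ b
  alg : ∀ l c → 1ℚ ℚ.* ((1ℚ ℚ.+ l ℚ.- c ℚ.+ 0ℚ) ℚ.* (1ℚ ℚ.+ l ℚ.+ c ℚ.- 0ℚ)) ≡ (l ℚ.- c ℚ.+ 1ℚ) ℚ.* (l ℚ.+ c ℚ.+ 1ℚ) ℚ.* 1ℚ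
  alg = solve-∀ ℚ-ring
I-suc-via-S b ℓ (suc n) = fromℕ-cancel-* (suc n) (suc n) (begin
  M₂ ℚ.* M₂ ℚ.* I b (suc ℓ) (suc (suc n))
    ≡⟨ I-step b (suc ℓ) (suc n) ⟩
  I b (suc ℓ) (suc n) ℚ.* ((L′ ℚ.- B ℚ.+ M₁) ℚ.* (L′ ℚ.+ B ℚ.- M₁))
    ≡⟨ cong (ℚ._* ((L′ ℚ.- B ℚ.+ M₁) ℚ.* (L′ ℚ.+ B ℚ.- M₁))) (I-suc-via-S b ℓ n) ⟩
  (L ℚ.- B ℚ.+ M₁) ℚ.* (L ℚ.+ B ℚ.+ 1ℚ) ℚ.* S b ℓ n ℚ.* ((L′ ℚ.- B ℚ.+ M₁) ℚ.* (L′ ℚ.+ B ℚ.- M₁))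
    ≡⟨ cong₂ (λ l m → (L ℚ.- B ℚ.+ M₁) ℚ.* (L ℚ.+ B ℚ.+ 1ℚ) ℚ.* S b ℓ n ℚ.* ((l ℚ.- B ℚ.+ M₁) ℚ.* (l ℚ.+ B ℚ.- m))) (fromℕ-suc ℓ) (fromℕ-suc n) ⟩
  (L ℚ.- B ℚ.+ M₁) ℚ.* (L ℚ.+ B ℚ.+ 1ℚ) ℚ.* S b ℓ n ℚ.* ((1ℚ ℚ.+ L ℚ.- B ℚ.+ M₁) ℚ.* (1ℚ ℚ.+ L ℚ.+ B ℚ.- (1ℚ ℚ.+ N)))
    ≡⟨ alg₁ L B N M₁ (S b ℓ n) ⟩
  (L ℚ.- B ℚ.+ (1ℚ ℚ.+ M₁)) ℚ.* (L ℚ.+ B ℚ.+ 1ℚ) ℚ.* (S b ℓ n ℚ.* ((L ℚ.- B ℚ.+ M₁) ℚ.* (L ℚ.+ B ℚ.- N)))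
    ≡⟨ cong₂ (λ m x → (L ℚ.- B ℚ.+ m) ℚ.* (L ℚ.+ B ℚ.+ 1ℚ) ℚ.* x) (fromℕ-suc (suc n)) (S-step b ℓ n) ⟨
  (L ℚ.- B ℚ.+ M₂) ℚ.* (L ℚ.+ B ℚ.+ 1ℚ) ℚ.* (M₂ ℚ.* M₂ ℚ.* S b ℓ (suc n))
    ≡⟨ alg₂ ((L ℚ.- B ℚ.+ M₂) ℚ.* (L ℚ.+ B ℚ.+ 1ℚ)) (M₂ ℚ.* M₂) (S b ℓ (suc n)) ⟩
  M₂ ℚ.* M₂ ℚ.* ((L ℚ.- B ℚ.+ M₂) ℚ.* (L ℚ.+ B ℚ.+ 1ℚ) ℚ.* S b ℓ (suc n))
    ∎)
  where
  open ≡-Reasoning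
  L = fromℕ ℓ
  L′ = fromℕ (suc ℓ)
  B = fromℕ b
  N = fromℕ n
  M₁ = fromℕ (suc n)
  M₂ = fromℕ (suc (suc n))
  alg₁ : ∀ l c n m s →
    (l ℚ.- c ℚ.+ m) ℚ.* (l ℚ.+ c ℚ.+ 1ℚ) ℚ.* s ℚ.* ((1ℚ ℚ.+ l ℚ.- c ℚ.+ m) ℚ.* (1ℚ ℚ.+ l ℚ.+ c ℚ.- (1ℚ ℚ.+ n)))
    ≡ (l ℚ.- c ℚ.+ (1ℚ ℚ.+ m)) ℚ.* (l ℚ.+ c ℚ.+ 1ℚ) ℚ.* (s ℚ.* ((l ℚ.- c ℚ.+ m) ℚ.* (l ℚ.+ c ℚ.- n)))
  alg₁ = solve-∀ ℚ-ring
  alg₂ : ∀ x y z → x ℚ.* (y ℚ.* z) ≡ y ℚ.* (x ℚ.* z)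
  alg₂ = solve-∀ ℚ-ring

θ : (ℕ → ℚ) → ℕ → ℚ
θ f n = fromℕ (suc n) ℚ.* f (suc n) ℚ.+ fromℕ n ℚ.* f n

I-contiguous : ∀ b ℓ n →
  θ (I b (suc ℓ)) n ℚ.- θ (I b ℓ) n
  ≡ (fromℕ b ℚ.+ fromℕ (suc ℓ)) ℚ.* I b (suc ℓ) n ℚ.+ (fromℕ ℓ ℚ.- fromℕ b) ℚ.* I b ℓ n
I-contiguous b ℓ zero = begin
  (1ℚ ℚ.* I b (suc ℓ) 1 ℚ.+ 0ℚ ℚ.* 1ℚ) ℚ.- (1ℚ ℚ.* I b ℓ 1 ℚ.+ 0ℚ ℚ.* 1ℚ)
    ≡⟨ cong₂ (λ x y → (1ℚ ℚ.* x ℚ.+ 0ℚ ℚ.* 1ℚ) ℚ.- (1ℚ ℚ.* y ℚ.+ 0ℚ ℚ.* 1ℚ)) (I-suc-via-S b ℓ 0) (I-via-S b ℓ 0) ⟩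
  (1ℚ ℚ.* ((L ℚ.- B ℚ.+ 1ℚ) ℚ.* (L ℚ.+ B ℚ.+ 1ℚ) ℚ.* 1ℚ) ℚ.+ 0ℚ ℚ.* 1ℚ) ℚ.- (1ℚ ℚ.* ((L ℚ.- B) ℚ.* (L ℚ.+ B ℚ.- 0ℚ) ℚ.* 1ℚ) ℚ.+ 0ℚ ℚ.* 1ℚ)
    ≡⟨ alg L B ⟩
  (B ℚ.+ (1ℚ ℚ.+ L)) ℚ.* 1ℚ ℚ.+ (L ℚ.- B) ℚ.* 1ℚ
    ≡⟨ cong (λ l → (B ℚ.+ l) ℚ.* 1ℚ ℚ.+ (L ℚ.- B) ℚ.* 1ℚ) (fromℕ-suc ℓ) ⟨
  (B ℚ.+ fromℕ (suc ℓ)) ℚ.* 1ℚ ℚ.+ (L ℚ.- B) ℚ.* 1ℚ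
    ∎
  where
  open ≡-Reasoning
  L = fromℕ ℓ
  B = fromℕ b
  alg : ∀ l c →
    (1ℚ ℚ.* ((l ℚ.- c ℚ.+ 1ℚ) ℚ.* (l ℚ.+ c ℚ.+ 1ℚ) ℚ.* 1ℚ) ℚ.+ 0ℚ ℚ.* 1ℚ) ℚ.- (1ℚ ℚ.* ((l ℚ.- c) ℚ.* (l ℚ.+ c ℚ.- 0ℚ) ℚ.* 1ℚ) ℚ.+ 0ℚ ℚ.* 1ℚ)
    ≡ (c ℚ.+ (1ℚ ℚ.+ l)) ℚ.* 1ℚ ℚ.+ (l ℚ.- c) ℚ.* 1ℚ
  alg = solve-∀ ℚ-ring
I-contiguous b ℓ (suc n) = begin
  (M₂ ℚ.* I b (suc ℓ) (suc (suc n)) ℚ.+ M₁ ℚ.* I b (suc ℓ) (suc n)) ℚ.- (M₂ ℚ.* I b ℓ (suc (suc n)) ℚ.+ M₁ ℚ.* I b ℓ (suc n))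
    ≡⟨ cong₂ ℚ._-_ (cong₂ (λ x y → M₂ ℚ.* x ℚ.+ M₁ ℚ.* y) (I-suc-via-S b ℓ (suc n)) (I-suc-via-S b ℓ n))
                   (cong₂ (λ x y → M₂ ℚ.* x ℚ.+ M₁ ℚ.* y) (I-via-S b ℓ (suc n)) (I-via-S b ℓ n)) ⟩
  (M₂ ℚ.* ((L ℚ.- B ℚ.+ M₂) ℚ.* (L ℚ.+ B ℚ.+ 1ℚ) ℚ.* s′) ℚ.+ M₁ ℚ.* ((L ℚ.- B ℚ.+ M₁) ℚ.* (L ℚ.+ B ℚ.+ 1ℚ) ℚ.* s))
    ℚ.- (M₂ ℚ.* ((L ℚ.- B) ℚ.* (L ℚ.+ B ℚ.- M₁) ℚ.* s′) ℚ.+ M₁ ℚ.* ((L ℚ.- B) ℚ.* (L ℚ.+ B ℚ.- N) ℚ.* s))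
    ≡⟨ alg₁ L B N M₁ M₂ s s′ (fromℕ-suc n) (fromℕ-suc (suc n)) ⟩
  (L ℚ.+ L ℚ.+ 1ℚ) ℚ.* (M₂ ℚ.* M₂ ℚ.* s′) ℚ.+ M₁ ℚ.* M₁ ℚ.* (L ℚ.+ L ℚ.+ 1ℚ) ℚ.* s
    ≡⟨ cong (λ x → (L ℚ.+ L ℚ.+ 1ℚ) ℚ.* x ℚ.+ M₁ ℚ.* M₁ ℚ.* (L ℚ.+ L ℚ.+ 1ℚ) ℚ.* s) (S-step b ℓ n) ⟩
  (L ℚ.+ L ℚ.+ 1ℚ) ℚ.* (s ℚ.* ((L ℚ.- B ℚ.+ M₁) ℚ.* (L ℚ.+ B ℚ.- N))) ℚ.+ M₁ ℚ.* M₁ ℚ.* (L ℚ.+ L ℚ.+ 1ℚ) ℚ.* s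
    ≡⟨ alg₂ L B N M₁ s (fromℕ-suc n) ⟩
  (B ℚ.+ (1ℚ ℚ.+ L)) ℚ.* ((L ℚ.- B ℚ.+ M₁) ℚ.* (L ℚ.+ B ℚ.+ 1ℚ) ℚ.* s) ℚ.+ (L ℚ.- B) ℚ.* ((L ℚ.- B) ℚ.* (L ℚ.+ B ℚ.- N) ℚ.* s)
    ≡⟨ cong (λ l → (B ℚ.+ l) ℚ.* ((L ℚ.- B ℚ.+ M₁) ℚ.* (L ℚ.+ B ℚ.+ 1ℚ) ℚ.* s) ℚ.+ (L ℚ.- B) ℚ.* ((L ℚ.- B) ℚ.* (L ℚ.+ B ℚ.- N) ℚ.* s)) (fromℕ-suc ℓ) ⟨
  (B ℚ.+ fromℕ (suc ℓ)) ℚ.* ((L ℚ.- B ℚ.+ M₁) ℚ.* (L ℚ.+ B ℚ.+ 1ℚ) ℚ.* s) ℚ.+ (L ℚ.- B) ℚ.* ((L ℚ.- B) ℚ.* (L ℚ.+ B ℚ.- N) ℚ.* s)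
    ≡⟨ cong₂ (λ x y → (B ℚ.+ fromℕ (suc ℓ)) ℚ.* x ℚ.+ (L ℚ.- B) ℚ.* y) (I-suc-via-S b ℓ n) (I-via-S b ℓ n) ⟨
  (B ℚ.+ fromℕ (suc ℓ)) ℚ.* I b (suc ℓ) (suc n) ℚ.+ (L ℚ.- B) ℚ.* I b ℓ (suc n)
    ∎
  where
  open ≡-Reasoning
  L = fromℕ ℓ
  B = fromℕ b
  N = fromℕ n
  M₁ = fromℕ (suc n)
  M₂ = fromℕ (suc (suc n))
  s = S b ℓ n
  s′ = S b ℓ (suc n)
  poly₁ : ∀ l c n s s′ →
    ((1ℚ ℚ.+ (1ℚ ℚ.+ n)) ℚ.* ((l ℚ.- c ℚ.+ (1ℚ ℚ.+ (1ℚ ℚ.+ n))) ℚ.* (l ℚ.+ c ℚ.+ 1ℚ) ℚ.* s′) ℚ.+ (1ℚ ℚ.+ n) ℚ.* ((l ℚ.- c ℚ.+ (1ℚ ℚ.+ n)) ℚ.* (l ℚ.+ c ℚ.+ 1ℚ) ℚ.* s))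
      ℚ.- ((1ℚ ℚ.+ (1ℚ ℚ.+ n)) ℚ.* ((l ℚ.- c) ℚ.* (l ℚ.+ c ℚ.- (1ℚ ℚ.+ n)) ℚ.* s′) ℚ.+ (1ℚ ℚ.+ n) ℚ.* ((l ℚ.- c) ℚ.* (l ℚ.+ c ℚ.- n) ℚ.* s))
    ≡ (l ℚ.+ l ℚ.+ 1ℚ) ℚ.* ((1ℚ ℚ.+ (1ℚ ℚ.+ n)) ℚ.* (1ℚ ℚ.+ (1ℚ ℚ.+ n)) ℚ.* s′) ℚ.+ (1ℚ ℚ.+ n) ℚ.* (1ℚ ℚ.+ n) ℚ.* (l ℚ.+ l ℚ.+ 1ℚ) ℚ.* s
  poly₁ = solve-∀ ℚ-ring
  alg₁ : ∀ l c n m₁ m₂ s s′ → m₁ ≡ 1ℚ ℚ.+ n → m₂ ≡ 1ℚ ℚ.+ m₁ →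
    (m₂ ℚ.* ((l ℚ.- c ℚ.+ m₂) ℚ.* (l ℚ.+ c ℚ.+ 1ℚ) ℚ.* s′) ℚ.+ m₁ ℚ.* ((l ℚ.- c ℚ.+ m₁) ℚ.* (l ℚ.+ c ℚ.+ 1ℚ) ℚ.* s))
      ℚ.- (m₂ ℚ.* ((l ℚ.- c) ℚ.* (l ℚ.+ c ℚ.- m₁) ℚ.* s′) ℚ.+ m₁ ℚ.* ((l ℚ.- c) ℚ.* (l ℚ.+ c ℚ.- n) ℚ.* s))
    ≡ (l ℚ.+ l ℚ.+ 1ℚ) ℚ.* (m₂ ℚ.* m₂ ℚ.* s′) ℚ.+ m₁ ℚ.* m₁ ℚ.* (l ℚ.+ l ℚ.+ 1ℚ) ℚ.* s
  alg₁ l c n _ _ s s′ refl refl = poly₁ l c n s s′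
  poly₂ : ∀ l c n s →
    (l ℚ.+ l ℚ.+ 1ℚ) ℚ.* (s ℚ.* ((l ℚ.- c ℚ.+ (1ℚ ℚ.+ n)) ℚ.* (l ℚ.+ c ℚ.- n))) ℚ.+ (1ℚ ℚ.+ n) ℚ.* (1ℚ ℚ.+ n) ℚ.* (l ℚ.+ l ℚ.+ 1ℚ) ℚ.* s
    ≡ (c ℚ.+ (1ℚ ℚ.+ l)) ℚ.* ((l ℚ.- c ℚ.+ (1ℚ ℚ.+ n)) ℚ.* (l ℚ.+ c ℚ.+ 1ℚ) ℚ.* s) ℚ.+ (l ℚ.- c) ℚ.* ((l ℚ.- c) ℚ.* (l ℚ.+ c ℚ.- n) ℚ.* s)
  poly₂ = solve-∀ ℚ-ring
  alg₂ : ∀ l c n m₁ s → m₁ ≡ 1ℚ ℚ.+ n →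
    (l ℚ.+ l ℚ.+ 1ℚ) ℚ.* (s ℚ.* ((l ℚ.- c ℚ.+ m₁) ℚ.* (l ℚ.+ c ℚ.- n))) ℚ.+ m₁ ℚ.* m₁ ℚ.* (l ℚ.+ l ℚ.+ 1ℚ) ℚ.* s
    ≡ (c ℚ.+ (1ℚ ℚ.+ l)) ℚ.* ((l ℚ.- c ℚ.+ m₁) ℚ.* (l ℚ.+ c ℚ.+ 1ℚ) ℚ.* s) ℚ.+ (l ℚ.- c) ℚ.* ((l ℚ.- c) ℚ.* (l ℚ.+ c ℚ.- n) ℚ.* s)
  alg₂ l c n _ s refl = poly₂ l c n s

J-via-S : ∀ b n → J b (suc n) ≡ fromℕ (suc n) ℚ.* S b 0 n
J-via-S b zero    = refl
J-via-S b (suc n) = fromℕ-cancel-* (suc n) n (begin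
  M₂ ℚ.* M₁ ℚ.* J b (suc (suc n))                                  ≡⟨ J-step b n ⟩
  ℚ.- (J b (suc n) ℚ.* ((B ℚ.- N) ℚ.* (B ℚ.- N ℚ.- 1ℚ)))
    ≡⟨ cong (λ x → ℚ.- (x ℚ.* ((B ℚ.- N) ℚ.* (B ℚ.- N ℚ.- 1ℚ)))) (J-via-S b n) ⟩
  ℚ.- (M₁ ℚ.* s ℚ.* ((B ℚ.- N) ℚ.* (B ℚ.- N ℚ.- 1ℚ)))              ≡⟨ alg₁ B N M₁ s ⟩
  M₁ ℚ.* (s ℚ.* ((0ℚ ℚ.- B ℚ.+ (1ℚ ℚ.+ N)) ℚ.* (0ℚ ℚ.+ B ℚ.- N)))
    ≡⟨ cong (λ m → M₁ ℚ.* (s ℚ.* ((0ℚ ℚ.- B ℚ.+ m) ℚ.* (0ℚ ℚ.+ B ℚ.- N)))) (fromℕ-suc n) ⟨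
  M₁ ℚ.* (s ℚ.* ((0ℚ ℚ.- B ℚ.+ M₁) ℚ.* (0ℚ ℚ.+ B ℚ.- N)))
    ≡⟨ cong (M₁ ℚ.*_) (S-step b 0 n) ⟨
  M₁ ℚ.* (M₂ ℚ.* M₂ ℚ.* S b 0 (suc n))                             ≡⟨ alg₂ M₁ M₂ (S b 0 (suc n)) ⟩
  M₂ ℚ.* M₁ ℚ.* (M₂ ℚ.* S b 0 (suc n))                             ∎)
  where
  open ≡-Reasoning
  B = fromℕ b
  N = fromℕ n
  M₁ = fromℕ (suc n)
  M₂ = fromℕ (suc (suc n))
  s = S b 0 n
  alg₁ : ∀ c n m s → ℚ.- (m ℚ.* s ℚ.* ((c ℚ.- n) ℚ.* (c ℚ.- n ℚ.- 1ℚ))) ≡ m ℚ.* (s ℚ.* ((0ℚ ℚ.- c ℚ.+ (1ℚ ℚ.+ n)) ℚ.* (0ℚ ℚ.+ c ℚ.- n)))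
  alg₁ = solve-∀ ℚ-ring
  alg₂ : ∀ m₁ m₂ s → m₁ ℚ.* (m₂ ℚ.* m₂ ℚ.* s) ≡ m₂ ℚ.* m₁ ℚ.* (m₂ ℚ.* s)
  alg₂ = solve-∀ ℚ-ring

J≡I₁-I₀ : ∀ b n → J b n ≡ I b 1 n ℚ.- I b 0 n
J≡I₁-I₀ b zero    = refl
J≡I₁-I₀ b (suc n) = begin
  J b (suc n)         ≡⟨ J-via-S b n ⟩
  M ℚ.* s             ≡⟨ alg B N M s (fromℕ-suc n) ⟩
  (0ℚ ℚ.- B ℚ.+ M) ℚ.* (0ℚ ℚ.+ B ℚ.+ 1ℚ) ℚ.* s ℚ.- (0ℚ ℚ.- B) ℚ.* (0ℚ ℚ.+ B ℚ.- N) ℚ.* s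
                      ≡⟨ cong₂ ℚ._-_ (I-suc-via-S b 0 n) (I-via-S b 0 n) ⟨
  I b 1 (suc n) ℚ.- I b 0 (suc n)  ∎
  where
  open ≡-Reasoning
  B = fromℕ b
  N = fromℕ n
  M = fromℕ (suc n)
  s = S b 0 n
  poly : ∀ c n s → (1ℚ ℚ.+ n) ℚ.* s ≡ (0ℚ ℚ.- c ℚ.+ (1ℚ ℚ.+ n)) ℚ.* (0ℚ ℚ.+ c ℚ.+ 1ℚ) ℚ.* s ℚ.- (0ℚ ℚ.- c) ℚ.* (0ℚ ℚ.+ c ℚ.- n) ℚ.* s
  poly = solve-∀ ℚ-ring
  alg : ∀ c n m s → m ≡ 1ℚ ℚ.+ n → m ℚ.* s ≡ (0ℚ ℚ.- c ℚ.+ m) ℚ.* (0ℚ ℚ.+ c ℚ.+ 1ℚ) ℚ.* s ℚ.- (0ℚ ℚ.- c) ℚ.* (0ℚ ℚ.+ c ℚ.- n) ℚ.* s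
  alg c n _ s refl = poly c n s

J-equation : ∀ b n → θ (J b) n ≡ fromℕ b ℚ.* J b n ℚ.+ I b 1 n
J-equation b n = begin
  M ℚ.* J b (suc n) ℚ.+ N ℚ.* J b n
    ≡⟨ cong₂ (λ x y → M ℚ.* x ℚ.+ N ℚ.* y) (J≡I₁-I₀ b (suc n)) (J≡I₁-I₀ b n) ⟩
  M ℚ.* (I b 1 (suc n) ℚ.- I b 0 (suc n)) ℚ.+ N ℚ.* (I b 1 n ℚ.- I b 0 n)
    ≡⟨ alg₁ M N (I b 1 (suc n)) (I b 0 (suc n)) (I b 1 n) (I b 0 n) ⟩
  θ (I b 1) n ℚ.- θ (I b 0) n
    ≡⟨ I-contiguous b 0 n ⟩
  (B ℚ.+ 1ℚ) ℚ.* I b 1 n ℚ.+ (0ℚ ℚ.- B) ℚ.* I b 0 n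
    ≡⟨ alg₂ B (I b 1 n) (I b 0 n) ⟩
  B ℚ.* (I b 1 n ℚ.- I b 0 n) ℚ.+ I b 1 n
    ≡⟨ cong (λ x → B ℚ.* x ℚ.+ I b 1 n) (J≡I₁-I₀ b n) ⟨
  B ℚ.* J b n ℚ.+ I b 1 n
    ∎
  where
  open ≡-Reasoning
  B = fromℕ b
  N = fromℕ n
  M = fromℕ (suc n)
  alg₁ : ∀ m n w x y z → m ℚ.* (w ℚ.- x) ℚ.+ n ℚ.* (y ℚ.- z) ≡ (m ℚ.* w ℚ.+ n ℚ.* y) ℚ.- (m ℚ.* x ℚ.+ n ℚ.* z)
  alg₁ = solve-∀ ℚ-ring
  alg₂ : ∀ c y z → (c ℚ.+ 1ℚ) ℚ.* y ℚ.+ (0ℚ ℚ.- c) ℚ.* z ≡ c ℚ.* (y ℚ.- z) ℚ.+ y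
  alg₂ = solve-∀ ℚ-ring

∑-last : ∀ n f → ∑ (suc n) f ≡ ∑ n f ℚ.+ f n
∑-last zero    f = trans (ℚ.+-identityʳ (f 0)) (sym (ℚ.+-identityˡ (f 0)))
∑-last (suc n) f = trans (cong (f 0 ℚ.+_) (∑-last n (λ i → f (suc i))))
                         (sym (ℚ.+-assoc (f 0) _ _))

-- At ℓ = b the series I is 1, which fixes the constant of summation.
I-equation : ∀ b ℓ n → let σ = λ m → ∑[ i < m ] (fromℕ (2 ℕ.* suc i) ℚ.* I b (suc i) n) in
  θ (I b ℓ) n ℚ.- fromℕ b ℚ.* I b ℓ n ≡ σ ℓ ℚ.- fromℕ ℓ ℚ.* I b ℓ n ℚ.- σ b
I-equation b ℓ n = begin
  θ (I b ℓ) n ℚ.- B ℚ.* I b ℓ n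
    ≡⟨ alg₁ (θ (I b ℓ) n) (B ℚ.* I b ℓ n) (σ ℓ) (fromℕ ℓ ℚ.* I b ℓ n) ⟩
  σ ℓ ℚ.- fromℕ ℓ ℚ.* I b ℓ n ℚ.- E ℓ
    ≡⟨ cong (λ x → σ ℓ ℚ.- fromℕ ℓ ℚ.* I b ℓ n ℚ.- x) (trans (E-const ℓ) (trans (sym (E-const b)) E-at-b)) ⟩
  σ ℓ ℚ.- fromℕ ℓ ℚ.* I b ℓ n ℚ.- σ b       ∎
  where
  open ≡-Reasoning
  B = fromℕ b
  summand σ : ℕ → ℚ
  summand i = fromℕ (2 ℕ.* suc i) ℚ.* I b (suc i) n
  σ m = ∑ m summand
  E : ℕ → ℚ
  E l = σ l ℚ.- fromℕ l ℚ.* I b l n ℚ.- (θ (I b l) n ℚ.- B ℚ.* I b l n)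
  alg₁ : ∀ t x s y → t ℚ.- x ≡ s ℚ.- y ℚ.- (s ℚ.- y ℚ.- (t ℚ.- x))
  alg₁ = solve-∀ ℚ-ring
  poly : ∀ c l s i i′ t t′ u → t′ ℚ.- t ≡ u →
    (s ℚ.+ (1ℚ ℚ.+ 1ℚ) ℚ.* (1ℚ ℚ.+ l) ℚ.* i′) ℚ.- (1ℚ ℚ.+ l) ℚ.* i′ ℚ.- (t′ ℚ.- c ℚ.* i′)
    ≡ s ℚ.- l ℚ.* i ℚ.- (t ℚ.- c ℚ.* i) ℚ.+ (((c ℚ.+ (1ℚ ℚ.+ l)) ℚ.* i′ ℚ.+ (l ℚ.- c) ℚ.* i) ℚ.- u)
  poly c l s i i′ t t′ _ refl = poly′ c l s i i′ t t′
    where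
    poly′ : ∀ c l s i i′ t t′ →
      (s ℚ.+ (1ℚ ℚ.+ 1ℚ) ℚ.* (1ℚ ℚ.+ l) ℚ.* i′) ℚ.- (1ℚ ℚ.+ l) ℚ.* i′ ℚ.- (t′ ℚ.- c ℚ.* i′)
      ≡ s ℚ.- l ℚ.* i ℚ.- (t ℚ.- c ℚ.* i) ℚ.+ (((c ℚ.+ (1ℚ ℚ.+ l)) ℚ.* i′ ℚ.+ (l ℚ.- c) ℚ.* i) ℚ.- (t′ ℚ.- t))
    poly′ = solve-∀ ℚ-ring
  E-suc : ∀ l → E (suc l) ≡ E l
  E-suc l = begin
    E (suc l)
      ≡⟨ cong (λ x → x ℚ.- fromℕ (suc l) ℚ.* I b (suc l) n ℚ.- (θ (I b (suc l)) n ℚ.- B ℚ.* I b (suc l) n))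
              (trans (∑-last l summand) (cong (λ x → σ l ℚ.+ x ℚ.* I b (suc l) n) (fromℕ-* 2 (suc l)))) ⟩
    (σ l ℚ.+ (1ℚ ℚ.+ 1ℚ) ℚ.* fromℕ (suc l) ℚ.* I b (suc l) n) ℚ.- fromℕ (suc l) ℚ.* I b (suc l) n ℚ.- (θ (I b (suc l)) n ℚ.- B ℚ.* I b (suc l) n)
      ≡⟨ cong (λ x → (σ l ℚ.+ (1ℚ ℚ.+ 1ℚ) ℚ.* x ℚ.* I b (suc l) n) ℚ.- x ℚ.* I b (suc l) n ℚ.- (θ (I b (suc l)) n ℚ.- B ℚ.* I b (suc l) n)) (fromℕ-suc l) ⟩
    (σ l ℚ.+ (1ℚ ℚ.+ 1ℚ) ℚ.* (1ℚ ℚ.+ fromℕ l) ℚ.* I b (suc l) n) ℚ.- (1ℚ ℚ.+ fromℕ l) ℚ.* I b (suc l) n ℚ.- (θ (I b (suc l)) n ℚ.- B ℚ.* I b (suc l) n)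
      ≡⟨ poly B (fromℕ l) (σ l) (I b l n) (I b (suc l) n) (θ (I b l) n) (θ (I b (suc l)) n) _
              (trans (I-contiguous b l n) (cong (λ x → (B ℚ.+ x) ℚ.* I b (suc l) n ℚ.+ (fromℕ l ℚ.- B) ℚ.* I b l n) (fromℕ-suc l))) ⟩
    E l ℚ.+ (((B ℚ.+ (1ℚ ℚ.+ fromℕ l)) ℚ.* I b (suc l) n ℚ.+ (fromℕ l ℚ.- B) ℚ.* I b l n) ℚ.- ((B ℚ.+ (1ℚ ℚ.+ fromℕ l)) ℚ.* I b (suc l) n ℚ.+ (fromℕ l ℚ.- B) ℚ.* I b l n))
      ≡⟨ cong (E l ℚ.+_) (ℚ.+-inverseʳ ((B ℚ.+ (1ℚ ℚ.+ fromℕ l)) ℚ.* I b (suc l) n ℚ.+ (fromℕ l ℚ.- B) ℚ.* I b l n)) ⟩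
    E l ℚ.+ 0ℚ
      ≡⟨ ℚ.+-identityʳ (E l) ⟩
    E l
      ∎
  E-const : ∀ l → E l ≡ E 0
  E-const zero    = refl
  E-const (suc l) = trans (E-suc l) (E-const l)
  I-vanishes : ∀ m → I b b (suc m) ≡ 0ℚ
  I-vanishes m = trans (I-via-S b b m)
    (trans (cong (λ x → x ℚ.* (B ℚ.+ B ℚ.- fromℕ m) ℚ.* S b b m) (ℚ.+-inverseʳ B)) (alg₂ (B ℚ.+ B ℚ.- fromℕ m) (S b b m)))
    where
    alg₂ : ∀ x y → 0ℚ ℚ.* x ℚ.* y ≡ 0ℚ
    alg₂ = solve-∀ ℚ-ring
  θ-vanishes : ∀ m → θ (I b b) m ≡ 0ℚ
  θ-vanishes zero    = cong (λ x → 1ℚ ℚ.* x ℚ.+ 0ℚ ℚ.* 1ℚ) (I-vanishes 0)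
  θ-vanishes (suc m) = trans (cong₂ (λ x y → fromℕ (suc (suc m)) ℚ.* x ℚ.+ fromℕ (suc m) ℚ.* y) (I-vanishes (suc m)) (I-vanishes m))
                             (alg₂ (fromℕ (suc (suc m))) (fromℕ (suc m)))
    where
    alg₂ : ∀ x y → x ℚ.* 0ℚ ℚ.+ y ℚ.* 0ℚ ≡ 0ℚ
    alg₂ = solve-∀ ℚ-ring
  E-at-b : E b ≡ σ b
  E-at-b = trans (cong (λ x → σ b ℚ.- B ℚ.* I b b n ℚ.- (x ℚ.- B ℚ.* I b b n)) (θ-vanishes n)) (alg₂ (σ b) (B ℚ.* I b b n))
    where
    alg₂ : ∀ s x → s ℚ.- x ℚ.- (0ℚ ℚ.- x) ≡ s
    alg₂ = solve-∀ ℚ-ring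

-- The Cauchy product

∑-zero : ∀ n {f} → (∀ i → f i ≡ 0ℚ) → ∑ n f ≡ 0ℚ
∑-zero zero    f≡0 = refl
∑-zero (suc n) f≡0 = cong₂ ℚ._+_ (f≡0 0) (∑-zero n (λ i → f≡0 (suc i)))

+-interchange : ∀ w x y z → (w ℚ.+ x) ℚ.+ (y ℚ.+ z) ≡ (w ℚ.+ y) ℚ.+ (x ℚ.+ z)
+-interchange = solve-∀ ℚ-ring

∑-+ : ∀ n f g → ∑ n (λ i → f i ℚ.+ g i) ≡ ∑ n f ℚ.+ ∑ n g
∑-+ zero    f g = refl
∑-+ (suc n) f g = trans (cong ((f 0 ℚ.+ g 0) ℚ.+_) (∑-+ n (λ i → f (suc i)) (λ i → g (suc i))))
                        (+-interchange (f 0) (g 0) _ _)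

∑-* : ∀ n c f → ∑ n (λ i → c ℚ.* f i) ≡ c ℚ.* ∑ n f
∑-* zero    c f = sym (ℚ.*-zeroʳ c)
∑-* (suc n) c f = trans (cong (c ℚ.* f 0 ℚ.+_) (∑-* n c (λ i → f (suc i))))
                        (sym (ℚ.*-distribˡ-+ c (f 0) _))

-- For m i j = f i · g j this is a coefficient of the Cauchy product in
-- one variable.  Note conv (suc a) m = m 0 (suc a) + conv a (m ∘ suc)
-- definitionally.
conv : ℕ → (ℕ → ℕ → ℚ) → ℚ
conv a m = ∑[ i < suc a ] m i (a ℕ.∸ i)

conv-cong : ∀ a {m m′} → (∀ i j → i ℕ.+ j ≡ a → m i j ≡ m′ i j) → conv a m ≡ conv a m′
conv-cong zero    eq = cong (ℚ._+ 0ℚ) (eq 0 0 refl)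
conv-cong (suc a) eq = cong₂ ℚ._+_ (eq 0 (suc a) refl)
                                   (conv-cong a (λ i j i+j≡a → eq (suc i) j (cong suc i+j≡a)))

conv-+ : ∀ a m m′ → conv a (λ i j → m i j ℚ.+ m′ i j) ≡ conv a m ℚ.+ conv a m′
conv-+ a m m′ = ∑-+ (suc a) (λ i → m i (a ℕ.∸ i)) (λ i → m′ i (a ℕ.∸ i))

conv-* : ∀ a c m → conv a (λ i j → c ℚ.* m i j) ≡ c ℚ.* conv a m
conv-* a c m = ∑-* (suc a) c (λ i → m i (a ℕ.∸ i))

conv-last : ∀ a m → conv (suc a) m ≡ conv a (λ i j → m i (suc j)) ℚ.+ m (suc a) 0
conv-last zero    m = rearr (m 0 1) (m 1 0)
  where
  rearr : ∀ x y → x ℚ.+ (y ℚ.+ 0ℚ) ≡ x ℚ.+ 0ℚ ℚ.+ y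
  rearr = solve-∀ ℚ-ring
conv-last (suc a) m = trans (cong (m 0 (suc (suc a)) ℚ.+_) (conv-last a (λ i → m (suc i))))
                            (sym (ℚ.+-assoc (m 0 (suc (suc a))) _ _))

conv-comm : ∀ a m → conv a m ≡ conv a (flip m)
conv-comm zero    m = refl
conv-comm (suc a) m = begin
  m 0 (suc a) ℚ.+ conv a (λ i → m (suc i))
    ≡⟨ cong (m 0 (suc a) ℚ.+_) (conv-comm a (λ i → m (suc i))) ⟩
  m 0 (suc a) ℚ.+ conv a (λ i j → m (suc j) i)     ≡⟨ ℚ.+-comm (m 0 (suc a)) _ ⟩
  conv a (λ i j → m (suc j) i) ℚ.+ m 0 (suc a)     ≡⟨ conv-last a (flip m) ⟨
  conv (suc a) (flip m)                            ∎
  where open ≡-Reasoning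

conv-assoc : ∀ a (h : ℕ → ℕ → ℕ → ℚ) →
  conv a (λ i j → conv i (λ k l → h k l j)) ≡ conv a (λ k n → conv n (h k))
conv-assoc zero    h = refl
conv-assoc (suc a) h = begin
  (h 0 0 (suc a) ℚ.+ 0ℚ) ℚ.+ conv a (λ i j → h 0 (suc i) j ℚ.+ conv i (λ k l → h (suc k) l j))
    ≡⟨ cong₂ ℚ._+_ (ℚ.+-identityʳ (h 0 0 (suc a)))
         (conv-+ a (λ i j → h 0 (suc i) j) (λ i j → conv i (λ k l → h (suc k) l j))) ⟩
  h 0 0 (suc a) ℚ.+ (conv a (λ i j → h 0 (suc i) j) ℚ.+ conv a (λ i j → conv i (λ k l → h (suc k) l j)))
    ≡⟨ ℚ.+-assoc (h 0 0 (suc a)) _ _ ⟨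
  conv (suc a) (h 0) ℚ.+ conv a (λ i j → conv i (λ k l → h (suc k) l j))
    ≡⟨ cong (conv (suc a) (h 0) ℚ.+_) (conv-assoc a (λ k → h (suc k))) ⟩
  conv (suc a) (h 0) ℚ.+ conv a (λ k n → conv n (h (suc k)))
    ∎
  where open ≡-Reasoning

conv-zero : ∀ a {m} → (∀ i j → m i j ≡ 0ℚ) → conv a m ≡ 0ℚ
conv-zero a m≡0 = ∑-zero (suc a) (λ i → m≡0 i (a ℕ.∸ i))

conv-leibniz : ∀ a m →
  fromℕ (suc a) ℚ.* conv (suc a) m
  ≡ conv a (λ i j → fromℕ (suc i) ℚ.* m (suc i) j ℚ.+ fromℕ (suc j) ℚ.* m i (suc j))
conv-leibniz a m = begin
  fromℕ (suc a) ℚ.* conv (suc a) m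
    ≡⟨ conv-* (suc a) (fromℕ (suc a)) m ⟨
  conv (suc a) (λ i j → fromℕ (suc a) ℚ.* m i j)
    ≡⟨ conv-cong (suc a) (λ i j i+j≡1+a → trans (cong (ℚ._* m i j) (trans (cong fromℕ (sym i+j≡1+a)) (fromℕ-+ i j)))
                                               (ℚ.*-distribʳ-+ (m i j) (fromℕ i) (fromℕ j))) ⟩
  conv (suc a) (λ i j → fromℕ i ℚ.* m i j ℚ.+ fromℕ j ℚ.* m i j)
    ≡⟨ conv-+ (suc a) (λ i j → fromℕ i ℚ.* m i j) (λ i j → fromℕ j ℚ.* m i j) ⟩
  conv (suc a) (λ i j → fromℕ i ℚ.* m i j) ℚ.+ conv (suc a) (λ i j → fromℕ j ℚ.* m i j)
    ≡⟨ cong₂ ℚ._+_ first second ⟩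
  conv a (λ i j → fromℕ (suc i) ℚ.* m (suc i) j) ℚ.+ conv a (λ i j → fromℕ (suc j) ℚ.* m i (suc j))
    ≡⟨ conv-+ a (λ i j → fromℕ (suc i) ℚ.* m (suc i) j) (λ i j → fromℕ (suc j) ℚ.* m i (suc j)) ⟨
  conv a (λ i j → fromℕ (suc i) ℚ.* m (suc i) j ℚ.+ fromℕ (suc j) ℚ.* m i (suc j))
    ∎
  where
  open ≡-Reasoning
  first : conv (suc a) (λ i j → fromℕ i ℚ.* m i j) ≡ conv a (λ i j → fromℕ (suc i) ℚ.* m (suc i) j)
  first = trans (cong (ℚ._+ conv a (λ i j → fromℕ (suc i) ℚ.* m (suc i) j)) (ℚ.*-zeroˡ (m 0 (suc a))))
                (ℚ.+-identityˡ _)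
  second : conv (suc a) (λ i j → fromℕ j ℚ.* m i j) ≡ conv a (λ i j → fromℕ (suc j) ℚ.* m i (suc j))
  second = trans (conv-last a (λ i j → fromℕ j ℚ.* m i j))
          (trans (cong (conv a (λ i j → fromℕ (suc j) ℚ.* m i (suc j)) ℚ.+_) (ℚ.*-zeroˡ (m (suc a) 0)))
                 (ℚ.+-identityʳ _))

infixl 5 _↾_

-- The coefficients of x₀^i in f, as a family in the remaining variables.
_↾_ : Coefficients → ℕ → Coefficients
(f ↾ i) α = f (i ∷ α)

mulᶜ-cong : ∀ {f f′ g g′} α →
  (∀ β γ → degree β ℕ.+ degree γ ≡ degree α → f β ℚ.* g γ ≡ f′ β ℚ.* g′ γ) →
  mulᶜ f g α ≡ mulᶜ f′ g′ α
mulᶜ-cong []      eq = eq [] [] refl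
mulᶜ-cong {f} {f′} {g} {g′} (a ∷ α) eq = conv-cong a λ i j i+j≡a → mulᶜ-cong {f ↾ i} {f′ ↾ i} {g ↾ j} {g′ ↾ j} α λ β γ β+γ≡α →
  eq (i ∷ β) (j ∷ γ) (trans (interchange i (degree β) j (degree γ)) (cong₂ ℕ._+_ i+j≡a β+γ≡α))
  where open import Algebra.Properties.CommutativeSemigroup ℕ.+-commutativeSemigroup using (interchange)

mulᶜ-congˡ : ∀ {f f′} g α → (∀ β → f β ≡ f′ β) → mulᶜ f g α ≡ mulᶜ f′ g α
mulᶜ-congˡ g α eq = mulᶜ-cong α (λ β γ _ → cong (ℚ._* g γ) (eq β))

mulᶜ-congʳ : ∀ f {g g′} α → (∀ β → g β ≡ g′ β) → mulᶜ f g α ≡ mulᶜ f g′ α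
mulᶜ-congʳ f α eq = mulᶜ-cong α (λ β γ _ → cong (f β ℚ.*_) (eq γ))

mulᶜ-zero : ∀ {f g} α → (∀ β γ → degree β ℕ.+ degree γ ≡ degree α → f β ℚ.* g γ ≡ 0ℚ) → mulᶜ f g α ≡ 0ℚ
mulᶜ-zero {f} {g} α eq = trans (mulᶜ-cong {g′ = g} α (λ β γ d → trans (eq β γ d) (sym (ℚ.*-zeroˡ (g γ))))) (zeroˡ g α)
  where
  zeroˡ : ∀ g α → mulᶜ (λ _ → 0ℚ) g α ≡ 0ℚ
  zeroˡ g []      = ℚ.*-zeroˡ (g [])
  zeroˡ g (a ∷ α) = conv-zero a (λ i j → zeroˡ (g ↾ j) α)

mulᶜ-comm : ∀ f g α → mulᶜ f g α ≡ mulᶜ g f α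
mulᶜ-comm f g []      = ℚ.*-comm (f []) (g [])
mulᶜ-comm f g (a ∷ α) = trans
  (conv-cong a (λ i j _ → mulᶜ-comm (f ↾ i) (g ↾ j) α))
  (conv-comm a (λ i j → mulᶜ (g ↾ j) (f ↾ i) α))

mulᶜ-+ˡ : ∀ f f′ g α → mulᶜ (λ β → f β ℚ.+ f′ β) g α ≡ mulᶜ f g α ℚ.+ mulᶜ f′ g α
mulᶜ-+ˡ f f′ g []      = ℚ.*-distribʳ-+ (g []) (f []) (f′ [])
mulᶜ-+ˡ f f′ g (a ∷ α) = trans
  (conv-cong a (λ i j _ → mulᶜ-+ˡ (f ↾ i) (f′ ↾ i) (g ↾ j) α))
  (conv-+ a (λ i j → mulᶜ (f ↾ i) (g ↾ j) α) (λ i j → mulᶜ (f′ ↾ i) (g ↾ j) α))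

mulᶜ-*ˡ : ∀ c f g α → mulᶜ (λ β → c ℚ.* f β) g α ≡ c ℚ.* mulᶜ f g α
mulᶜ-*ˡ c f g []      = ℚ.*-assoc c (f []) (g [])
mulᶜ-*ˡ c f g (a ∷ α) = trans
  (conv-cong a (λ i j _ → mulᶜ-*ˡ c (f ↾ i) (g ↾ j) α))
  (conv-* a c (λ i j → mulᶜ (f ↾ i) (g ↾ j) α))

mulᶜ-+ʳ : ∀ f g g′ α → mulᶜ f (λ β → g β ℚ.+ g′ β) α ≡ mulᶜ f g α ℚ.+ mulᶜ f g′ α
mulᶜ-+ʳ f g g′ α = trans (mulᶜ-comm f _ α)
  (trans (mulᶜ-+ˡ g g′ f α) (cong₂ ℚ._+_ (mulᶜ-comm g f α) (mulᶜ-comm g′ f α)))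

mulᶜ-*ʳ : ∀ c f g α → mulᶜ f (λ β → c ℚ.* g β) α ≡ c ℚ.* mulᶜ f g α
mulᶜ-*ʳ c f g α = trans (mulᶜ-comm f _ α) (trans (mulᶜ-*ˡ c g f α) (cong (c ℚ.*_) (mulᶜ-comm g f α)))

mulᶜ-∑ˡ : ∀ n (f : ℕ → Coefficients) g α →
  mulᶜ (λ β → ∑[ i < n ] f i β) g α ≡ ∑[ i < n ] mulᶜ (f i) g α
mulᶜ-∑ˡ zero    f g α = mulᶜ-zero α (λ β γ _ → ℚ.*-zeroˡ (g γ))
mulᶜ-∑ˡ (suc n) f g α = trans (mulᶜ-+ˡ (f 0) _ g α)
  (cong (mulᶜ (f 0) g α ℚ.+_) (mulᶜ-∑ˡ n (f ∘ suc) g α))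

mulᶜ-∑ʳ : ∀ n f (g : ℕ → Coefficients) α →
  mulᶜ f (λ β → ∑[ i < n ] g i β) α ≡ ∑[ i < n ] mulᶜ f (g i) α
mulᶜ-∑ʳ n f g α = trans (mulᶜ-comm f _ α)
  (trans (mulᶜ-∑ˡ n g f α) (∑-cong n (λ i → mulᶜ-comm (g i) f α)))

mulᶜ-assoc : ∀ f g h α → mulᶜ (mulᶜ f g) h α ≡ mulᶜ f (mulᶜ g h) α
mulᶜ-assoc f g h []      = ℚ.*-assoc (f []) (g []) (h [])
mulᶜ-assoc f g h (a ∷ α) = begin
  conv a (λ i j → mulᶜ (λ β → conv i (λ k l → mulᶜ (f ↾ k) (g ↾ l) β)) (h ↾ j) α)
    ≡⟨ conv-cong a (λ i j _ → trans
         (mulᶜ-∑ˡ (suc i) (λ k → mulᶜ (f ↾ k) (g ↾ i ℕ.∸ k)) (h ↾ j) α)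
         (conv-cong i (λ k l _ → mulᶜ-assoc (f ↾ k) (g ↾ l) (h ↾ j) α))) ⟩
  conv a (λ i j → conv i (λ k l → mulᶜ (f ↾ k) (mulᶜ (g ↾ l) (h ↾ j)) α))
    ≡⟨ conv-assoc a (λ k l j → mulᶜ (f ↾ k) (mulᶜ (g ↾ l) (h ↾ j)) α) ⟩
  conv a (λ k n → conv n (λ l j → mulᶜ (f ↾ k) (mulᶜ (g ↾ l) (h ↾ j)) α))
    ≡⟨ conv-cong a (λ k n _ → sym (mulᶜ-∑ʳ (suc n) (f ↾ k) (λ l → mulᶜ (g ↾ l) (h ↾ n ℕ.∸ l)) α)) ⟩
  conv a (λ k n → mulᶜ (f ↾ k) (λ β → conv n (λ l j → mulᶜ (g ↾ l) (h ↾ j) β)) α)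
    ∎
  where open ≡-Reasoning

mulᶜ-constˡ : ∀ c f α → mulᶜ (constᶜ c) f α ≡ c ℚ.* f α
mulᶜ-constˡ c f []          = refl
mulᶜ-constˡ c f (zero  ∷ α) = trans (ℚ.+-identityʳ _) (mulᶜ-constˡ c (f ↾ 0) α)
mulᶜ-constˡ c f (suc a ∷ α) = trans
  (cong₂ ℚ._+_ (mulᶜ-constˡ c (f ↾ suc a) α)
               (conv-zero a (λ i j → mulᶜ-zero {λ _ → 0ℚ} {f ↾ j} α (λ β γ _ → ℚ.*-zeroˡ (f (j ∷ γ))))))
  (ℚ.+-identityʳ _)

-- Derivations

∑x·ᶜ-cong : ∀ {f g} α → (∀ ℓ β → degree β ℕ.≤ degree α → f ℓ β ≡ g ℓ β) → ∑x·ᶜ f α ≡ ∑x·ᶜ g α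
∑x·ᶜ-cong         []      eq = refl
∑x·ᶜ-cong {f} {g} (a ∷ α) eq = cong₂ ℚ._+_ (head a (eq 0))
  (∑x·ᶜ-cong {λ ℓ → f (suc ℓ) ↾ a} {λ ℓ → g (suc ℓ) ↾ a} α (λ ℓ β β≤α → eq (suc ℓ) (a ∷ β) (ℕ.+-monoʳ-≤ a β≤α)))
  where
  head : ∀ a → (∀ β → degree β ℕ.≤ degree (a ∷ α) → f 0 β ≡ g 0 β) → x·ᶜ 0 (f 0) (a ∷ α) ≡ x·ᶜ 0 (g 0) (a ∷ α)
  head zero    eq = refl
  head (suc a) eq = eq (a ∷ α) (ℕ.n≤1+n _)

∑x·ᶜ-+ : ∀ f g α → ∑x·ᶜ (λ ℓ β → f ℓ β ℚ.+ g ℓ β) α ≡ ∑x·ᶜ f α ℚ.+ ∑x·ᶜ g α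
∑x·ᶜ-+ f g []      = refl
∑x·ᶜ-+ f g (a ∷ α) = trans
  (cong₂ ℚ._+_ (head a) (∑x·ᶜ-+ (λ ℓ → f (suc ℓ) ↾ a) (λ ℓ → g (suc ℓ) ↾ a) α))
  (+-interchange (x·ᶜ 0 (f 0) (a ∷ α)) _ _ _)
  where
  head : ∀ a → x·ᶜ 0 (λ β → f 0 β ℚ.+ g 0 β) (a ∷ α) ≡ x·ᶜ 0 (f 0) (a ∷ α) ℚ.+ x·ᶜ 0 (g 0) (a ∷ α)
  head zero    = refl
  head (suc a) = refl

∑x·ᶜ-* : ∀ c f α → ∑x·ᶜ (λ ℓ β → c ℚ.* f ℓ β) α ≡ c ℚ.* ∑x·ᶜ f α
∑x·ᶜ-* c f []      = sym (ℚ.*-zeroʳ c)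
∑x·ᶜ-* c f (a ∷ α) = trans
  (cong₂ ℚ._+_ (head a) (∑x·ᶜ-* c (λ ℓ → f (suc ℓ) ↾ a) α))
  (sym (ℚ.*-distribˡ-+ c (x·ᶜ 0 (f 0) (a ∷ α)) _))
  where
  head : ∀ a → x·ᶜ 0 (λ β → c ℚ.* f 0 β) (a ∷ α) ≡ c ℚ.* x·ᶜ 0 (f 0) (a ∷ α)
  head zero    = sym (ℚ.*-zeroʳ c)
  head (suc a) = refl

∑x·ᶜ-zero : ∀ α → ∑x·ᶜ (λ _ _ → 0ℚ) α ≡ 0ℚ
∑x·ᶜ-zero []          = refl
∑x·ᶜ-zero (zero  ∷ α) = cong (0ℚ ℚ.+_) (∑x·ᶜ-zero α)
∑x·ᶜ-zero (suc a ∷ α) = cong (0ℚ ℚ.+_) (∑x·ᶜ-zero α)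

∑x·ᶜ-∑ : ∀ n (f : ℕ → ℕ → Coefficients) α →
  ∑x·ᶜ (λ ℓ β → ∑[ i < n ] f i ℓ β) α ≡ ∑[ i < n ] ∑x·ᶜ (f i) α
∑x·ᶜ-∑ zero    f α = ∑x·ᶜ-zero α
∑x·ᶜ-∑ (suc n) f α = trans (∑x·ᶜ-+ (f 0) (λ ℓ β → ∑[ i < n ] f (suc i) ℓ β) α) (cong (∑x·ᶜ (f 0) α ℚ.+_) (∑x·ᶜ-∑ n (f ∘ suc) α))

mulᶜ-∑x·ˡ : ∀ f g α → mulᶜ (∑x·ᶜ f) g α ≡ ∑x·ᶜ (λ ℓ → mulᶜ (f ℓ) g) α
mulᶜ-∑x·ˡ f g []      = ℚ.*-zeroˡ (g [])
mulᶜ-∑x·ˡ f g (a ∷ α) = begin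
  conv a (λ i j → mulᶜ (λ β → x·ᶜ 0 (f 0) (i ∷ β) ℚ.+ ∑x·ᶜ (λ ℓ → f (suc ℓ) ↾ i) β) (g ↾ j) α)
    ≡⟨ conv-cong a (λ i j _ → mulᶜ-+ˡ (x·ᶜ 0 (f 0) ↾ i) (∑x·ᶜ (λ ℓ → f (suc ℓ) ↾ i)) (g ↾ j) α) ⟩
  conv a (λ i j → mulᶜ (x·ᶜ 0 (f 0) ↾ i) (g ↾ j) α ℚ.+ mulᶜ (∑x·ᶜ (λ ℓ → f (suc ℓ) ↾ i)) (g ↾ j) α)
    ≡⟨ conv-+ a (λ i j → mulᶜ (x·ᶜ 0 (f 0) ↾ i) (g ↾ j) α) (λ i j → mulᶜ (∑x·ᶜ (λ ℓ → f (suc ℓ) ↾ i)) (g ↾ j) α) ⟩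
  conv a (λ i j → mulᶜ (x·ᶜ 0 (f 0) ↾ i) (g ↾ j) α) ℚ.+ conv a (λ i j → mulᶜ (∑x·ᶜ (λ ℓ → f (suc ℓ) ↾ i)) (g ↾ j) α)
    ≡⟨ cong₂ ℚ._+_ (head a) (conv-cong a (λ i j _ → mulᶜ-∑x·ˡ (λ ℓ → f (suc ℓ) ↾ i) (g ↾ j) α)) ⟩
  x·ᶜ 0 (mulᶜ (f 0) g) (a ∷ α) ℚ.+ conv a (λ i j → ∑x·ᶜ (λ ℓ → mulᶜ (f (suc ℓ) ↾ i) (g ↾ j)) α)
    ≡⟨ cong (x·ᶜ 0 (mulᶜ (f 0) g) (a ∷ α) ℚ.+_)
         (∑x·ᶜ-∑ (suc a) (λ i ℓ → mulᶜ (f (suc ℓ) ↾ i) (g ↾ a ℕ.∸ i)) α) ⟨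
  ∑x·ᶜ (λ ℓ → mulᶜ (f ℓ) g) (a ∷ α)
    ∎
  where
  open ≡-Reasoning
  zeroˡ : ∀ j → mulᶜ (λ _ → 0ℚ) (g ↾ j) α ≡ 0ℚ
  zeroˡ j = mulᶜ-zero {λ _ → 0ℚ} {g ↾ j} α (λ β γ _ → ℚ.*-zeroˡ (g (j ∷ γ)))
  head : ∀ a → conv a (λ i j → mulᶜ (x·ᶜ 0 (f 0) ↾ i) (g ↾ j) α) ≡ x·ᶜ 0 (mulᶜ (f 0) g) (a ∷ α)
  head zero    = cong (ℚ._+ 0ℚ) (zeroˡ 0)
  head (suc a) = trans (cong (ℚ._+ conv a (λ i j → mulᶜ (f 0 ↾ i) (g ↾ j) α)) (zeroˡ (suc a))) (ℚ.+-identityˡ _)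

mulᶜ-∑x·ʳ : ∀ f g α → mulᶜ f (∑x·ᶜ g) α ≡ ∑x·ᶜ (λ ℓ → mulᶜ f (g ℓ)) α
mulᶜ-∑x·ʳ f g α = trans (mulᶜ-comm f (∑x·ᶜ g) α) (trans (mulᶜ-∑x·ˡ g f α)
  (∑x·ᶜ-cong α (λ ℓ β _ → mulᶜ-comm (g ℓ) f β)))

∂ᶜ : ℕ → Coefficients → Coefficients
∂ᶜ k f α = fromℕ (suc (exponent k α)) ℚ.* f (raise k α)

∂ᶜ-leibniz : ∀ k {f g} → WellDefined f → WellDefined g → ∀ α →
  ∂ᶜ k (mulᶜ f g) α ≡ mulᶜ (∂ᶜ k f) g α ℚ.+ mulᶜ f (∂ᶜ k g) α
∂ᶜ-leibniz zero {f} {g} f-wd g-wd [] = trans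
  (cong₂ (λ x y → 1ℚ ℚ.* (x ℚ.* g (1 ∷ []) ℚ.+ (f (1 ∷ []) ℚ.* y ℚ.+ 0ℚ))) (f-wd []) (g-wd []))
  (rearr (f []) (f (1 ∷ [])) (g []) (g (1 ∷ [])))
  where
  rearr : ∀ x x′ y y′ → 1ℚ ℚ.* (x ℚ.* y′ ℚ.+ (x′ ℚ.* y ℚ.+ 0ℚ)) ≡ 1ℚ ℚ.* x′ ℚ.* y ℚ.+ x ℚ.* (1ℚ ℚ.* y′)
  rearr = solve-∀ ℚ-ring
∂ᶜ-leibniz (suc k) {f} {g} f-wd g-wd [] = trans
  (cong (1ℚ ℚ.*_) (ℚ.+-identityʳ (mulᶜ (f ↾ 0) (g ↾ 0) (raise k []))))
  (trans (∂ᶜ-leibniz k {f ↾ 0} {g ↾ 0} (λ α → f-wd (0 ∷ α)) (λ α → g-wd (0 ∷ α)) [])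
         (cong₂ (λ x y → ∂ᶜ (suc k) f [] ℚ.* y ℚ.+ x ℚ.* ∂ᶜ (suc k) g []) (f-wd []) (g-wd [])))
∂ᶜ-leibniz zero {f} {g} f-wd g-wd (a ∷ α) = begin
  fromℕ (suc a) ℚ.* conv (suc a) m
    ≡⟨ conv-leibniz a m ⟩
  conv a (λ i j → fromℕ (suc i) ℚ.* m (suc i) j ℚ.+ fromℕ (suc j) ℚ.* m i (suc j))
    ≡⟨ conv-cong a (λ i j _ → cong₂ ℚ._+_ (mulᶜ-*ˡ (fromℕ (suc i)) (f ↾ suc i) (g ↾ j) α)
                                          (mulᶜ-*ʳ (fromℕ (suc j)) (f ↾ i) (g ↾ suc j) α)) ⟨
  conv a (λ i j → mulᶜ (∂ᶜ 0 f ↾ i) (g ↾ j) α ℚ.+ mulᶜ (f ↾ i) (∂ᶜ 0 g ↾ j) α)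
    ≡⟨ conv-+ a (λ i j → mulᶜ (∂ᶜ 0 f ↾ i) (g ↾ j) α) (λ i j → mulᶜ (f ↾ i) (∂ᶜ 0 g ↾ j) α) ⟩
  mulᶜ (∂ᶜ 0 f) g (a ∷ α) ℚ.+ mulᶜ f (∂ᶜ 0 g) (a ∷ α)
    ∎
  where
  open ≡-Reasoning
  m : ℕ → ℕ → ℚ
  m i j = mulᶜ (f ↾ i) (g ↾ j) α
∂ᶜ-leibniz (suc k) {f} {g} f-wd g-wd (a ∷ α) = begin
  fromℕ (suc (exponent k α)) ℚ.* conv a (λ i j → mulᶜ (f ↾ i) (g ↾ j) (raise k α))
    ≡⟨ conv-* a (fromℕ (suc (exponent k α))) (λ i j → mulᶜ (f ↾ i) (g ↾ j) (raise k α)) ⟨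
  conv a (λ i j → ∂ᶜ k (mulᶜ (f ↾ i) (g ↾ j)) α)
    ≡⟨ conv-cong a (λ i j _ → ∂ᶜ-leibniz k {f ↾ i} {g ↾ j} (λ β → f-wd (i ∷ β)) (λ β → g-wd (j ∷ β)) α) ⟩
  conv a (λ i j → mulᶜ (∂ᶜ k (f ↾ i)) (g ↾ j) α ℚ.+ mulᶜ (f ↾ i) (∂ᶜ k (g ↾ j)) α)
    ≡⟨ conv-+ a (λ i j → mulᶜ (∂ᶜ k (f ↾ i)) (g ↾ j) α) (λ i j → mulᶜ (f ↾ i) (∂ᶜ k (g ↾ j)) α) ⟩
  mulᶜ (∂ᶜ (suc k) f) g (a ∷ α) ℚ.+ mulᶜ f (∂ᶜ (suc k) g) (a ∷ α)
    ∎
  where open ≡-Reasoning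

degree-raise : ∀ k α → degree (raise k α) ≡ suc (degree α)
degree-raise zero    []      = refl
degree-raise zero    (a ∷ α) = refl
degree-raise (suc k) []      = degree-raise k []
degree-raise (suc k) (a ∷ α) = trans (cong (a ℕ.+_) (degree-raise k α)) (ℕ.+-suc a (degree α))

-- Locality bounds the loss of degree, so that a derivation commutes with
-- the degreewise finite sums defining a substitution.
record IsDerivation (D : FPS → Coefficients) : Set where
  field
    local   : ∀ {F G} α → (∀ β → degree β ℕ.≤ suc (degree α) → coeff F β ≡ coeff G β) → D F α ≡ D G α
    +-homo  : ∀ F G α → D (F + G) α ≡ D F α ℚ.+ D G α
    •-homo  : ∀ c F α → D (c • F) α ≡ c ℚ.* D F α
    leibniz : ∀ F G α → D (F * G) α ≡ mulᶜ (D F) (coeff G) α ℚ.+ mulᶜ (coeff F) (D G) α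

open IsDerivation

∂-isDerivation : ∀ k → IsDerivation (λ F → coeff (∂ k F))
∂-isDerivation k = record
  { local   = λ α F≡G → cong (fromℕ (suc (exponent k α)) ℚ.*_) (F≡G (raise k α) (ℕ.≤-reflexive (degree-raise k α)))
  ; +-homo  = λ F G α → ℚ.*-distribˡ-+ (fromℕ (suc (exponent k α))) (coeff F (raise k α)) (coeff G (raise k α))
  ; •-homo  = λ c F α → swap (fromℕ (suc (exponent k α))) c (coeff F (raise k α))
  ; leibniz = λ F G → ∂ᶜ-leibniz k (wellDefined F) (wellDefined G)
  }
  where
  swap : ∀ x y z → x ℚ.* (y ℚ.* z) ≡ y ℚ.* (x ℚ.* z)
  swap = solve-∀ ℚ-ring

zero-isDerivation : IsDerivation (λ _ _ → 0ℚ)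
zero-isDerivation = record
  { local   = λ _ _ → refl
  ; +-homo  = λ _ _ _ → refl
  ; •-homo  = λ c _ _ → sym (ℚ.*-zeroʳ c)
  ; leibniz = λ F G α → sym (cong₂ ℚ._+_
      (mulᶜ-zero {λ _ → 0ℚ} {coeff G} α (λ β γ _ → ℚ.*-zeroˡ (coeff G γ)))
      (mulᶜ-zero {coeff F} {λ _ → 0ℚ} α (λ β γ _ → ℚ.*-zeroʳ (coeff F β))))
  }

+-isDerivation : ∀ {D E} → IsDerivation D → IsDerivation E → IsDerivation (λ F α → D F α ℚ.+ E F α)
+-isDerivation {D} {E} d e = record
  { local   = λ α F≡G → cong₂ ℚ._+_ (local d α F≡G) (local e α F≡G)
  ; +-homo  = λ F G α → trans (cong₂ ℚ._+_ (+-homo d F G α) (+-homo e F G α)) (+-interchange (D F α) (D G α) (E F α) (E G α))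
  ; •-homo  = λ c F α → trans (cong₂ ℚ._+_ (•-homo d c F α) (•-homo e c F α)) (sym (ℚ.*-distribˡ-+ c (D F α) (E F α)))
  ; leibniz = λ F G α → trans (cong₂ ℚ._+_ (leibniz d F G α) (leibniz e F G α))
      (trans (+-interchange (mulᶜ (D F) (coeff G) α) _ _ _)
             (sym (cong₂ ℚ._+_ (mulᶜ-+ˡ (D F) (E F) (coeff G) α) (mulᶜ-+ʳ (coeff F) (D G) (E G) α))))
  }

•-isDerivation : ∀ {D} c → IsDerivation D → IsDerivation (λ F α → c ℚ.* D F α)
•-isDerivation {D} c d = record
  { local   = λ α F≡G → cong (c ℚ.*_) (local d α F≡G)
  ; +-homo  = λ F G α → trans (cong (c ℚ.*_) (+-homo d F G α)) (ℚ.*-distribˡ-+ c (D F α) (D G α))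
  ; •-homo  = λ e F α → trans (cong (c ℚ.*_) (•-homo d e F α)) (swap c e (D F α))
  ; leibniz = λ F G α → trans (cong (c ℚ.*_) (leibniz d F G α))
      (trans (ℚ.*-distribˡ-+ c (mulᶜ (D F) (coeff G) α) _)
             (sym (cong₂ ℚ._+_ (mulᶜ-*ˡ c (D F) (coeff G) α) (mulᶜ-*ʳ c (coeff F) (D G) α))))
  }
  where
  swap : ∀ x y z → x ℚ.* (y ℚ.* z) ≡ y ℚ.* (x ℚ.* z)
  swap = solve-∀ ℚ-ring

isDerivation-resp : ∀ {D E} → (∀ F α → D F α ≡ E F α) → IsDerivation D → IsDerivation E
isDerivation-resp {D} {E} D≡E d = record
  { local   = λ {F} {G} α F≡G → trans (sym (D≡E F α)) (trans (local d {F} {G} α F≡G) (D≡E G α))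
  ; +-homo  = λ F G α → trans (sym (D≡E (F + G) α)) (trans (+-homo d F G α) (cong₂ ℚ._+_ (D≡E F α) (D≡E G α)))
  ; •-homo  = λ c F α → trans (sym (D≡E (c • F) α)) (trans (•-homo d c F α) (cong (c ℚ.*_) (D≡E F α)))
  ; leibniz = λ F G α → trans (sym (D≡E (F * G) α)) (trans (leibniz d F G α)
      (cong₂ ℚ._+_ (mulᶜ-congˡ (coeff G) α (D≡E F)) (mulᶜ-congʳ (coeff F) α (D≡E G))))
  }

-‿isDerivation : ∀ {D} → IsDerivation D → IsDerivation (λ F α → ℚ.- D F α)
-‿isDerivation {D} d = isDerivation-resp (λ F α → -1* (D F α)) (•-isDerivation (ℚ.- 1ℚ) d)
  where
  -1* : ∀ x → (ℚ.- 1ℚ) ℚ.* x ≡ ℚ.- x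
  -1* = solve-∀ ℚ-ring

∑-isDerivation : ∀ n {D : ℕ → FPS → Coefficients} → (∀ i → IsDerivation (D i)) →
  IsDerivation (λ F α → ∑[ i < n ] D i F α)
∑-isDerivation zero    d = zero-isDerivation
∑-isDerivation (suc n) d = +-isDerivation (d 0) (∑-isDerivation n (λ i → d (suc i)))

∑x·-isDerivation : ∀ {D : ℕ → FPS → Coefficients} → (∀ ℓ → IsDerivation (D ℓ)) →
  IsDerivation (λ F → ∑x·ᶜ (λ ℓ → D ℓ F))
∑x·-isDerivation {D} d = record
  { local   = λ {F} {G} α F≡G → ∑x·ᶜ-cong α (λ ℓ β β≤α →
      local (d ℓ) {F} {G} β (λ γ γ≤β → F≡G γ (ℕ.≤-trans γ≤β (s≤s β≤α))))
  ; +-homo  = λ F G α → trans (∑x·ᶜ-cong α (λ ℓ β _ → +-homo (d ℓ) F G β)) (∑x·ᶜ-+ (λ ℓ → D ℓ F) (λ ℓ → D ℓ G) α)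
  ; •-homo  = λ c F α → trans (∑x·ᶜ-cong α (λ ℓ β _ → •-homo (d ℓ) c F β)) (∑x·ᶜ-* c (λ ℓ → D ℓ F) α)
  ; leibniz = λ F G α → trans (∑x·ᶜ-cong α (λ ℓ β _ → leibniz (d ℓ) F G β))
      (trans (∑x·ᶜ-+ (λ ℓ → mulᶜ (D ℓ F) (coeff G)) (λ ℓ → mulᶜ (coeff F) (D ℓ G)) α)
             (sym (cong₂ ℚ._+_ (mulᶜ-∑x·ˡ (λ ℓ → D ℓ F) (coeff G) α) (mulᶜ-∑x·ʳ (coeff F) (λ ℓ → D ℓ G) α))))
  }

Dstr-isDerivation : ∀ b → IsDerivation (λ F → coeff (Dstr b F))
Dstr-isDerivation b = +-isDerivation (∂-isDerivation 1)
  (-‿isDerivation (∑x·-isDerivation (λ ℓ → +-isDerivation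
    (+-isDerivation (-‿isDerivation (•-isDerivation (fromℕ ℓ) (∂-isDerivation ℓ)))
                    (∑-isDerivation ℓ 2k∂k))
    (-‿isDerivation (∑-isDerivation b 2k∂k)))))
  where
  2k∂k : ∀ i → IsDerivation (λ F → coeff (fromℕ (2 ℕ.* suc i) • ∂ (suc i) F))
  2k∂k i = •-isDerivation (fromℕ (2 ℕ.* suc i)) (∂-isDerivation (suc i))

Ddil-isDerivation : IsDerivation (λ F → coeff (Ddil F))
Ddil-isDerivation = +-isDerivation
  (+-isDerivation (∂-isDerivation 1) (-‿isDerivation (∂-isDerivation 0)))
  (-‿isDerivation (∑x·-isDerivation ∂-isDerivation))

-- Substitution r = R

constᶜ-0 : ∀ α → constᶜ 0ℚ α ≡ 0ℚ
constᶜ-0 []          = refl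
constᶜ-0 (zero  ∷ α) = constᶜ-0 α
constᶜ-0 (suc _ ∷ α) = refl

FPS-commutativeRing : CommutativeRing _ _
FPS-commutativeRing = record
  { Carrier = FPS
  ; _≈_ = _≈_
  ; _+_ = _+_
  ; _*_ = _*_
  ; -_ = -_
  ; 0# = 0#
  ; 1# = 1#
  ; isCommutativeRing = record
    { isRing = record
      { +-isAbelianGroup = record
        { isGroup = record
          { isMonoid = record
            { isSemigroup = record
              { isMagma = record
                { isEquivalence = record
                  { refl  = λ _ → refl
                  ; sym   = λ F≈G α → sym (F≈G α)
                  ; trans = λ F≈G G≈H α → trans (F≈G α) (G≈H α)
                  }
                ; ∙-cong = λ F≈F′ G≈G′ α → cong₂ ℚ._+_ (F≈F′ α) (G≈G′ α)
                }
              ; assoc = λ F G H α → ℚ.+-assoc (coeff F α) (coeff G α) (coeff H α)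
              }
            ; identity = (λ F α → trans (cong (ℚ._+ coeff F α) (constᶜ-0 α)) (ℚ.+-identityˡ (coeff F α)))
                       , (λ F α → trans (cong (coeff F α ℚ.+_) (constᶜ-0 α)) (ℚ.+-identityʳ (coeff F α)))
            }
          ; inverse = (λ F α → trans (ℚ.+-inverseˡ (coeff F α)) (sym (constᶜ-0 α)))
                    , (λ F α → trans (ℚ.+-inverseʳ (coeff F α)) (sym (constᶜ-0 α)))
          ; ⁻¹-cong = λ F≈G α → cong ℚ.-_ (F≈G α)
          }
        ; comm = λ F G α → ℚ.+-comm (coeff F α) (coeff G α)
        }
      ; *-cong = λ F≈F′ G≈G′ α → mulᶜ-cong α (λ β γ _ → cong₂ ℚ._*_ (F≈F′ β) (G≈G′ γ))
      ; *-assoc = λ F G H → mulᶜ-assoc (coeff F) (coeff G) (coeff H)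
      ; *-identity = (λ F α → trans (mulᶜ-constˡ 1ℚ (coeff F) α) (ℚ.*-identityˡ (coeff F α)))
                   , (λ F α → trans (mulᶜ-comm (coeff F) (constᶜ 1ℚ) α)
                              (trans (mulᶜ-constˡ 1ℚ (coeff F) α) (ℚ.*-identityˡ (coeff F α))))
      ; distrib = (λ F G H → mulᶜ-+ʳ (coeff F) (coeff G) (coeff H))
                , (λ F G H → mulᶜ-+ˡ (coeff G) (coeff H) (coeff F))
      }
    ; *-comm = λ F G → mulᶜ-comm (coeff F) (coeff G)
    }
  }

module FPS-Solver = Algebra.Solver.Ring.NaturalCoefficients.Default
  (CommutativeRing.commutativeSemiring FPS-commutativeRing)
open FPS-Solver using (solve; _:=_; _:+_; _:*_)

open CommutativeRing FPS-commutativeRing using (zeroˡ; zeroʳ; *-identityˡ; *-identityʳ; +-identityˡ)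

•≈const* : ∀ c F → c • F ≈ const c * F
•≈const* c F α = sym (mulᶜ-constˡ c (coeff F) α)

degree≡0⇒const : ∀ {f} → WellDefined f → ∀ α → degree α ≡ 0 → f α ≡ f []
degree≡0⇒const f-wd []         _ = refl
degree≡0⇒const f-wd (zero ∷ α) e = trans (degree≡0⇒const (λ β → f-wd (0 ∷ β)) α e) (f-wd [])

module _ {R : FPS} (R[]≡0 : coeff R [] ≡ 0ℚ) where

  ^-vanishes : ∀ n α → degree α ℕ.< n → coeff (R ^ n) α ≡ 0ℚ
  ^-vanishes (suc n) α (s≤s α≤n) = mulᶜ-zero {coeff R} {coeff (R ^ n)} α λ β γ β+γ≡α →
    split β γ (degree β) refl (ℕ.≤-trans (ℕ.≤-reflexive β+γ≡α) α≤n)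
    where
    split : ∀ β γ d → degree β ≡ d → degree β ℕ.+ degree γ ℕ.≤ n → coeff R β ℚ.* coeff (R ^ n) γ ≡ 0ℚ
    split β γ zero    e _ = trans (cong (ℚ._* coeff (R ^ n) γ) (trans (degree≡0⇒const (wellDefined R) β e) R[]≡0))
                                  (ℚ.*-zeroˡ (coeff (R ^ n) γ))
    split β γ (suc d) e β+γ≤n = trans
      (cong (coeff R β ℚ.*_) (^-vanishes n γ (ℕ.≤-trans (s≤s (ℕ.m≤n+m (degree γ) d))
        (ℕ.≤-trans (ℕ.≤-reflexive (cong (ℕ._+ degree γ) (sym e))) β+γ≤n))))
      (ℚ.*-zeroʳ (coeff R β))

  *^-vanishes : ∀ G n α → degree α ℕ.< n → coeff (G * R ^ n) α ≡ 0ℚ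
  *^-vanishes G n α α<n = mulᶜ-zero {coeff G} {coeff (R ^ n)} α λ β γ β+γ≡α → trans
    (cong (coeff G β ℚ.*_) (^-vanishes n γ (ℕ.≤-<-trans (ℕ.≤-trans (ℕ.m≤n+m (degree γ) (degree β)) (ℕ.≤-reflexive β+γ≡α)) α<n)))
    (ℚ.*-zeroʳ (coeff G β))

partialSum : ℕ → FPS[[r]] → FPS → FPS
partialSum zero    F R = 0#
partialSum (suc N) F R = partialSum N F R + F N * R ^ N

partialSum-coeff : ∀ N F R α → coeff (partialSum N F R) α ≡ ∑[ n < N ] coeff (F n * R ^ n) α
partialSum-coeff zero    F R α = constᶜ-0 α
partialSum-coeff (suc N) F R α = trans
  (cong (ℚ._+ coeff (F N * R ^ N) α) (partialSum-coeff N F R α))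
  (sym (∑-last N (λ n → coeff (F n * R ^ n) α)))

∣r=-partialSum : ∀ F {R} → coeff R [] ≡ 0ℚ → ∀ N α → degree α ℕ.< N →
  coeff (F ∣r= R) α ≡ coeff (partialSum N F R) α
∣r=-partialSum F {R} R[]≡0 N α α<N = trans (sym (stable (N ℕ.∸ suc (degree α))))
  (cong (λ n → coeff (partialSum n F R) α) (ℕ.m∸n+n≡m α<N))
  where
  stable : ∀ k → coeff (partialSum (k ℕ.+ suc (degree α)) F R) α ≡ coeff (F ∣r= R) α
  stable zero    = partialSum-coeff (suc (degree α)) F R α
  stable (suc k) = trans
    (cong₂ ℚ._+_ (stable k) (*^-vanishes {R} R[]≡0 (F (k ℕ.+ suc (degree α))) (k ℕ.+ suc (degree α)) α (ℕ.m≤n+m _ k)))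
    (ℚ.+-identityʳ _)

∣r=-cong : ∀ {F G : FPS[[r]]} R → (∀ n → F n ≈ G n) → F ∣r= R ≈ G ∣r= R
∣r=-cong R F≈G α = ∑-cong (suc (degree α)) (λ n → mulᶜ-congˡ (coeff (R ^ n)) α (F≈G n))

∣r=-+ : ∀ F G R → (λ n → F n + G n) ∣r= R ≈ F ∣r= R + G ∣r= R
∣r=-+ F G R α = trans
  (∑-cong (suc (degree α)) (λ n → mulᶜ-+ˡ (coeff (F n)) (coeff (G n)) (coeff (R ^ n)) α))
  (∑-+ (suc (degree α)) (λ n → coeff (F n * R ^ n) α) (λ n → coeff (G n * R ^ n) α))

∣r=-• : ∀ c F R → (λ n → c • F n) ∣r= R ≈ c • F ∣r= R
∣r=-• c F R α = trans
  (∑-cong (suc (degree α)) (λ n → mulᶜ-*ˡ c (coeff (F n)) (coeff (R ^ n)) α))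
  (∑-* (suc (degree α)) c (λ n → coeff (F n * R ^ n) α))

partialSum-[1+r]· : ∀ N F R → partialSum (suc N) ([1+r]· F) R ≈ partialSum (suc N) F R + R * partialSum N F R
partialSum-[1+r]· zero    F R α = sym (trans
  (cong (coeff (partialSum 1 F R) α ℚ.+_) (trans (zeroʳ R α) (constᶜ-0 α)))
  (ℚ.+-identityʳ _))
partialSum-[1+r]· (suc N) F R α = trans
  (cong (ℚ._+ coeff ((F (suc N) + F N) * R ^ suc N) α) (partialSum-[1+r]· N F R α))
  (step (partialSum (suc N) F R) (partialSum N F R) (F (suc N)) (F N) R (R ^ N) α)
  where
  step : ∀ P P′ F₁ F₀ R Rᴺ → (P + R * P′) + (F₁ + F₀) * (R * Rᴺ) ≈ (P + F₁ * (R * Rᴺ)) + R * (P′ + F₀ * Rᴺ)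
  step = solve 6 (λ P P′ F₁ F₀ R Rᴺ → (P :+ R :* P′) :+ (F₁ :+ F₀) :* (R :* Rᴺ) := (P :+ F₁ :* (R :* Rᴺ)) :+ R :* (P′ :+ F₀ :* Rᴺ)) (λ _ → refl)

∣r=-[1+r]· : ∀ F {R} → coeff R [] ≡ 0ℚ → [1+r]· F ∣r= R ≈ (1# + R) * F ∣r= R
∣r=-[1+r]· F {R} R[]≡0 α = begin
  coeff ([1+r]· F ∣r= R) α
    ≡⟨ ∣r=-partialSum ([1+r]· F) R[]≡0 (suc N) α (s≤s (ℕ.n≤1+n _)) ⟩
  coeff (partialSum (suc N) ([1+r]· F) R) α
    ≡⟨ partialSum-[1+r]· N F R α ⟩
  coeff (partialSum (suc N) F R) α ℚ.+ coeff (R * partialSum N F R) α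
    ≡⟨ cong₂ ℚ._+_ (∣r=-partialSum F R[]≡0 (suc N) α (s≤s (ℕ.n≤1+n _)))
         (mulᶜ-cong {coeff R} {coeff R} {coeff (F ∣r= R)} {coeff (partialSum N F R)} α (λ β γ β+γ≡α → cong (coeff R β ℚ.*_)
           (∣r=-partialSum F R[]≡0 N γ (s≤s (ℕ.≤-trans (ℕ.m≤n+m _ (degree β)) (ℕ.≤-reflexive β+γ≡α)))))) ⟨
  coeff (F ∣r= R) α ℚ.+ coeff (R * F ∣r= R) α
    ≡⟨ expand R (F ∣r= R) α ⟩
  coeff ((1# + R) * F ∣r= R) α
    ∎
  where
  open ≡-Reasoning
  N = suc (degree α)
  expand : ∀ R X → X + R * X ≈ (1# + R) * X
  expand R X α = sym (trans (mulᶜ-+ˡ (coeff 1#) (coeff R) (coeff X) α) (cong (ℚ._+ coeff (R * X) α) (*-identityˡ X α)))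

module _ (D : FPS → FPS) (d : IsDerivation (λ F → coeff (D F))) where

  D-cong : ∀ {F G} → F ≈ G → D F ≈ D G
  D-cong {F} {G} F≈G α = local d {F} {G} α (λ β _ → F≈G β)

  D-0# : D 0# ≈ 0#
  D-0# α = begin
    coeff (D 0#) α
      ≡⟨ D-cong {0#} {0ℚ • 0#} (λ β → trans (constᶜ-0 β) (sym (ℚ.*-zeroˡ (constᶜ 0ℚ β)))) α ⟩
    coeff (D (0ℚ • 0#)) α       ≡⟨ •-homo d 0ℚ 0# α ⟩
    0ℚ ℚ.* coeff (D 0#) α       ≡⟨ ℚ.*-zeroˡ (coeff (D 0#) α) ⟩
    0ℚ                          ≡⟨ constᶜ-0 α ⟨
    constᶜ 0ℚ α                 ∎
    where open ≡-Reasoning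

  D-^ : ∀ R n → D (R ^ suc n) ≈ fromℕ (suc n) • (R ^ n * D R)
  D-^ R zero α = trans (D-cong {R * 1#} {R} (*-identityʳ R) α)
    (sym (trans (ℚ.*-identityˡ _) (*-identityˡ (D R) α)))
  D-^ R (suc n) α = begin
    coeff (D (R * R ^ suc n)) α
      ≡⟨ leibniz d R (R ^ suc n) α ⟩
    coeff (D R * R ^ suc n) α ℚ.+ coeff (R * D (R ^ suc n)) α
      ≡⟨ cong₂ ℚ._+_ (mulᶜ-comm (coeff (D R)) (coeff (R ^ suc n)) α)
                     (trans (mulᶜ-congʳ (coeff R) α (D-^ R n))
                     (trans (mulᶜ-*ʳ (fromℕ (suc n)) (coeff R) (coeff (R ^ n * D R)) α)
                            (cong (fromℕ (suc n) ℚ.*_) (sym (mulᶜ-assoc (coeff R) (coeff (R ^ n)) (coeff (D R)) α))))) ⟩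
    y ℚ.+ fromℕ (suc n) ℚ.* y
      ≡⟨ collect (fromℕ (suc n)) y ⟩
    (1ℚ ℚ.+ fromℕ (suc n)) ℚ.* y
      ≡⟨ cong (ℚ._* y) (fromℕ-suc (suc n)) ⟨
    fromℕ (suc (suc n)) ℚ.* y
      ∎
    where
    open ≡-Reasoning
    y = coeff (R ^ suc n * D R) α
    collect : ∀ c y → y ℚ.+ c ℚ.* y ≡ (1ℚ ℚ.+ c) ℚ.* y
    collect = solve-∀ ℚ-ring

  D-partialSum : ∀ N F R →
    D (partialSum (suc N) F R) ≈ partialSum (suc N) (λ n → D (F n)) R + partialSum N (∂ᵣ F) R * D R
  D-partialSum zero F R α = trans
    (D-cong {0# + F 0 * 1#} {F 0} (left (F 0)) α)
    (right (D (F 0)) (D R) α)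
    where
    left : ∀ X → 0# + X * 1# ≈ X
    left X α = trans (+-identityˡ (X * 1#) α) (*-identityʳ X α)
    right : ∀ X Y → X ≈ (0# + X * 1#) + 0# * Y
    right X Y α = sym (trans (cong₂ ℚ._+_ (left X α) (trans (zeroˡ Y α) (constᶜ-0 α))) (ℚ.+-identityʳ _))
  D-partialSum (suc N) F R α = begin
    coeff (D (partialSum (suc N) F R + F₁ * R ^ suc N)) α
      ≡⟨ +-homo d (partialSum (suc N) F R) (F₁ * R ^ suc N) α ⟩
    coeff (D (partialSum (suc N) F R)) α ℚ.+ coeff (D (F₁ * R ^ suc N)) α
      ≡⟨ cong₂ ℚ._+_ (D-partialSum N F R α) (trans (leibniz d F₁ (R ^ suc N) α)
           (cong (coeff (D F₁ * R ^ suc N) α ℚ.+_) (mulᶜ-congʳ (coeff F₁) α (λ β → trans (D-^ R N β) (•≈const* c (R ^ N * D R) β))))) ⟩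
    coeff ((P + P′ * D R) + (D F₁ * R ^ suc N + F₁ * (const c * (R ^ N * D R)))) α
      ≡⟨ rearr P P′ (D R) (D F₁ * R ^ suc N) F₁ (const c) (R ^ N) α ⟩
    coeff ((P + D F₁ * R ^ suc N) + (P′ + (const c * F₁) * R ^ N) * D R) α
      ≡⟨ cong (coeff (P + D F₁ * R ^ suc N) α ℚ.+_) (mulᶜ-congˡ (coeff (D R)) α
           (λ β → cong (coeff P′ β ℚ.+_) (mulᶜ-congˡ (coeff (R ^ N)) β (•≈const* c F₁)))) ⟨
    coeff ((P + D F₁ * R ^ suc N) + (P′ + (c • F₁) * R ^ N) * D R) α
      ∎
    where
    open ≡-Reasoning
    F₁ = F (suc N)
    c = fromℕ (suc N)
    P = partialSum (suc N) (λ n → D (F n)) R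
    P′ = partialSum N (∂ᵣ F) R
    rearr : ∀ P P′ X Y F₁ C Z → (P + P′ * X) + (Y + F₁ * (C * (Z * X))) ≈ (P + Y) + (P′ + (C * F₁) * Z) * X
    rearr = solve 7 (λ P P′ X Y F₁ C Z → (P :+ P′ :* X) :+ (Y :+ F₁ :* (C :* (Z :* X))) := (P :+ Y) :+ (P′ :+ (C :* F₁) :* Z) :* X) (λ _ → refl)

  chain-rule : ∀ F {R} → coeff R [] ≡ 0ℚ → D (F ∣r= R) ≈ (λ n → D (F n)) ∣r= R + ∂ᵣ F ∣r= R * D R
  chain-rule F {R} R[]≡0 α = begin
    coeff (D (F ∣r= R)) α
      ≡⟨ local d {F ∣r= R} {partialSum (suc N) F R} α (λ β β≤1+α → ∣r=-partialSum F R[]≡0 (suc N) β (s≤s β≤1+α)) ⟩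
    coeff (D (partialSum (suc N) F R)) α
      ≡⟨ D-partialSum N F R α ⟩
    coeff (partialSum (suc N) (λ n → D (F n)) R) α ℚ.+ coeff (partialSum N (∂ᵣ F) R * D R) α
      ≡⟨ cong₂ ℚ._+_ (∣r=-partialSum (λ n → D (F n)) R[]≡0 (suc N) α (s≤s (ℕ.n≤1+n _)))
           (mulᶜ-cong {coeff (∂ᵣ F ∣r= R)} {coeff (partialSum N (∂ᵣ F) R)} {coeff (D R)} {coeff (D R)} α
             (λ β γ β+γ≡α → cong (ℚ._* coeff (D R) γ)
             (∣r=-partialSum (∂ᵣ F) R[]≡0 N β (s≤s (ℕ.≤-trans (ℕ.m≤m+n (degree β) _) (ℕ.≤-reflexive β+γ≡α)))))) ⟨
    coeff ((λ n → D (F n)) ∣r= R + ∂ᵣ F ∣r= R * D R) α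
      ∎
    where
    open ≡-Reasoning
    N = suc (degree α)

-- With W = 1 - A, which has zero constant term, A X = 0 says X = W X, so
-- X is divisible by every power of W.
*-cancel-unit : ∀ A X → coeff A [] ≡ 1ℚ → A * X ≈ 0# → X ≈ 0#
*-cancel-unit A X A[]≡1 AX≈0 α = trans (X≈XWⁿ (suc (degree α)) α)
  (trans (*^-vanishes {W} W[]≡0 X (suc (degree α)) α ℕ.≤-refl) (sym (constᶜ-0 α)))
  where
  W = 1# - A
  W[]≡0 : coeff W [] ≡ 0ℚ
  W[]≡0 = cong (λ x → 1ℚ ℚ.- x) A[]≡1
  X≈XW : X ≈ X * W
  X≈XW β = begin
    coeff X β                                ≡⟨ *-identityʳ X β ⟨
    coeff (X * 1#) β
      ≡⟨ mulᶜ-congʳ (coeff X) β (λ γ → 1≡W+A (constᶜ 1ℚ γ) (coeff A γ)) ⟩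
    coeff (X * (W + A)) β                    ≡⟨ mulᶜ-+ʳ (coeff X) (coeff W) (coeff A) β ⟩
    coeff (X * W) β ℚ.+ coeff (X * A) β
      ≡⟨ cong (coeff (X * W) β ℚ.+_) (trans (mulᶜ-comm (coeff X) (coeff A) β) (trans (AX≈0 β) (constᶜ-0 β))) ⟩
    coeff (X * W) β ℚ.+ 0ℚ                   ≡⟨ ℚ.+-identityʳ _ ⟩
    coeff (X * W) β                          ∎
    where
    open ≡-Reasoning
    1≡W+A : ∀ e a → e ≡ (e ℚ.- a) ℚ.+ a
    1≡W+A = solve-∀ ℚ-ring
  X≈XWⁿ : ∀ n → X ≈ X * W ^ n
  X≈XWⁿ zero    β = sym (*-identityʳ X β)
  X≈XWⁿ (suc n) β = trans (X≈XWⁿ n β) (trans (mulᶜ-congˡ (coeff (W ^ n)) β X≈XW) (mulᶜ-assoc (coeff X) (coeff W) (coeff (W ^ n)) β))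

-- The action of Dstr and Ddil on Ž

constᶜ-* : ∀ c d α → constᶜ (c ℚ.* d) α ≡ c ℚ.* constᶜ d α
constᶜ-* c d []          = refl
constᶜ-* c d (zero  ∷ α) = constᶜ-* c d α
constᶜ-* c d (suc _ ∷ α) = sym (ℚ.*-zeroʳ c)

constᶜ-scale : ∀ c α → constᶜ c α ≡ c ℚ.* constᶜ 1ℚ α
constᶜ-scale c α = trans (cong (λ d → constᶜ d α) (sym (ℚ.*-identityʳ c))) (constᶜ-* c 1ℚ α)

constᶜ-raise : ∀ c k α → constᶜ c (raise k α) ≡ 0ℚ
constᶜ-raise c zero    []          = refl
constᶜ-raise c zero    (_ ∷ α)     = refl
constᶜ-raise c (suc k) []          = constᶜ-raise c k []
constᶜ-raise c (suc k) (zero  ∷ α) = constᶜ-raise c k α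
constᶜ-raise c (suc k) (suc _ ∷ α) = refl

affine : ℚ → (ℕ → ℚ) → FPS
affine j i = const j - ∑x· (λ ℓ → const (i ℓ))

∂ᶜ-∑x·const : ∀ k (c : ℕ → ℚ) α → ∂ᶜ k (∑x·ᶜ (λ ℓ → constᶜ (c ℓ))) α ≡ constᶜ (c k) α
∂ᶜ-∑x·const zero    c []          = trans (ℚ.*-identityˡ _) (ℚ.+-identityʳ (c 0))
∂ᶜ-∑x·const zero    c (a ∷ α)     = trans
  (cong (fromℕ (suc a) ℚ.*_) (trans (cong (constᶜ (c 0) (a ∷ α) ℚ.+_) (∑x·ᶜ-zero α)) (ℚ.+-identityʳ _)))
  (scale a)
  where
  scale : ∀ a → fromℕ (suc a) ℚ.* constᶜ (c 0) (a ∷ α) ≡ constᶜ (c 0) (a ∷ α)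
  scale zero    = ℚ.*-identityˡ (constᶜ (c 0) α)
  scale (suc a) = ℚ.*-zeroʳ (fromℕ (suc (suc a)))
∂ᶜ-∑x·const (suc k) c []          = trans (cong (1ℚ ℚ.*_) (ℚ.+-identityˡ (∑x·ᶜ (λ ℓ → constᶜ (c (suc ℓ))) (raise k [])))) (∂ᶜ-∑x·const k (c ∘ suc) [])
∂ᶜ-∑x·const (suc k) c (zero  ∷ α) = trans (cong (fromℕ (suc (exponent k α)) ℚ.*_) (ℚ.+-identityˡ _))
                                          (∂ᶜ-∑x·const k (c ∘ suc) α)
∂ᶜ-∑x·const (suc k) c (suc a ∷ α) = trans
  (cong (fromℕ (suc (exponent k α)) ℚ.*_) (cong₂ ℚ._+_ (head a) (∑x·ᶜ-zero (raise k α))))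
  (ℚ.*-zeroʳ (fromℕ (suc (exponent k α))))
  where
  head : ∀ a → constᶜ (c 0) (a ∷ raise k α) ≡ 0ℚ
  head zero    = constᶜ-raise (c 0) k α
  head (suc a) = refl

∂-affine : ∀ k j i α → coeff (∂ k (affine j i)) α ≡ ℚ.- constᶜ (i k) α
∂-affine k j i α = begin
  e ℚ.* (constᶜ j (raise k α) ℚ.- X (raise k α))
    ≡⟨ cong (λ x → e ℚ.* (x ℚ.- X (raise k α))) (constᶜ-raise j k α) ⟩
  e ℚ.* (0ℚ ℚ.- X (raise k α))                      ≡⟨ rearr e (X (raise k α)) ⟩
  ℚ.- (e ℚ.* X (raise k α))                         ≡⟨ cong ℚ.-_ (∂ᶜ-∑x·const k i α) ⟩
  ℚ.- constᶜ (i k) α                                ∎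
  where
  open ≡-Reasoning
  e = fromℕ (suc (exponent k α))
  X = ∑x·ᶜ (λ ℓ → constᶜ (i ℓ))
  rearr : ∀ e x → e ℚ.* (0ℚ ℚ.- x) ≡ ℚ.- (e ℚ.* x)
  rearr = solve-∀ ℚ-ring

affine-cong : ∀ {j j′ i i′} → j ≡ j′ → (∀ ℓ → i ℓ ≡ i′ ℓ) → affine j i ≈ affine j′ i′
affine-cong {j} {i = i} {i′} refl i≡i′ α = cong (λ x → constᶜ j α ℚ.- x)
  (∑x·ᶜ-cong {λ ℓ → constᶜ (i ℓ)} {λ ℓ → constᶜ (i′ ℓ)} α (λ ℓ β _ → cong (λ c → constᶜ c β) (i≡i′ ℓ)))

affine-linear : ∀ c d j j′ i i′ →
  affine (c ℚ.* j ℚ.+ d ℚ.* j′) (λ ℓ → c ℚ.* i ℓ ℚ.+ d ℚ.* i′ ℓ) ≈ c • affine j i + d • affine j′ i′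
affine-linear c d j j′ i i′ α = begin
  constᶜ (c ℚ.* j ℚ.+ d ℚ.* j′) α ℚ.- ∑x·ᶜ (λ ℓ → constᶜ (c ℚ.* i ℓ ℚ.+ d ℚ.* i′ ℓ)) α
    ≡⟨ cong₂ ℚ._-_ (constᶜ-linear j j′ α) (trans (∑x·ᶜ-cong α (λ ℓ β _ → constᶜ-linear (i ℓ) (i′ ℓ) β))
         (trans (∑x·ᶜ-+ (λ ℓ β → c ℚ.* constᶜ (i ℓ) β) (λ ℓ β → d ℚ.* constᶜ (i′ ℓ) β) α)
                (cong₂ ℚ._+_ (∑x·ᶜ-* c (λ ℓ → constᶜ (i ℓ)) α) (∑x·ᶜ-* d (λ ℓ → constᶜ (i′ ℓ)) α)))) ⟩
  (c ℚ.* constᶜ j α ℚ.+ d ℚ.* constᶜ j′ α) ℚ.- (c ℚ.* ∑x·ᶜ (λ ℓ → constᶜ (i ℓ)) α ℚ.+ d ℚ.* ∑x·ᶜ (λ ℓ → constᶜ (i′ ℓ)) α)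
    ≡⟨ rearr c d (constᶜ j α) (constᶜ j′ α) (∑x·ᶜ (λ ℓ → constᶜ (i ℓ)) α) (∑x·ᶜ (λ ℓ → constᶜ (i′ ℓ)) α) ⟩
  c ℚ.* coeff (affine j i) α ℚ.+ d ℚ.* coeff (affine j′ i′) α
    ∎
  where
  open ≡-Reasoning
  rearr : ∀ c d x x′ y y′ → (c ℚ.* x ℚ.+ d ℚ.* x′) ℚ.- (c ℚ.* y ℚ.+ d ℚ.* y′) ≡ c ℚ.* (x ℚ.- y) ℚ.+ d ℚ.* (x′ ℚ.- y′)
  rearr = solve-∀ ℚ-ring
  constᶜ-linear : ∀ x y β → constᶜ (c ℚ.* x ℚ.+ d ℚ.* y) β ≡ c ℚ.* constᶜ x β ℚ.+ d ℚ.* constᶜ y β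
  constᶜ-linear x y β = trans (constᶜ-scale _ β) (trans (distrib c d x y (constᶜ 1ℚ β))
    (sym (cong₂ (λ x y → c ℚ.* x ℚ.+ d ℚ.* y) (constᶜ-scale x β) (constᶜ-scale y β))))
    where
    distrib : ∀ c d x y e → (c ℚ.* x ℚ.+ d ℚ.* y) ℚ.* e ≡ c ℚ.* (x ℚ.* e) ℚ.+ d ℚ.* (y ℚ.* e)
    distrib = solve-∀ ℚ-ring

Dstr-affine : ∀ b j i → let σ = λ m → ∑[ k < m ] (fromℕ (2 ℕ.* suc k) ℚ.* i (suc k)) in
  Dstr b (affine j i) ≈ affine (ℚ.- i 1) (λ ℓ → fromℕ ℓ ℚ.* i ℓ ℚ.- σ ℓ ℚ.+ σ b)
Dstr-affine b j i α = cong₂ ℚ._-_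
  (trans (∂-affine 1 j i α) (sym (constᶜ-neg (i 1) α)))
  (∑x·ᶜ-cong α (λ ℓ β _ → summand ℓ β))
  where
  open ≡-Reasoning
  σ : ℕ → ℚ
  σ m = ∑[ k < m ] (fromℕ (2 ℕ.* suc k) ℚ.* i (suc k))
  constᶜ-neg : ∀ c β → constᶜ (ℚ.- c) β ≡ ℚ.- constᶜ c β
  constᶜ-neg c β = trans (constᶜ-scale _ β) (trans (sym (ℚ.neg-distribˡ-* c (constᶜ 1ℚ β)))
    (cong ℚ.-_ (sym (constᶜ-scale c β))))
  2k∂k : ∀ m β → ∑[ k < m ] coeff (fromℕ (2 ℕ.* suc k) • ∂ (suc k) (affine j i)) β ≡ (ℚ.- constᶜ 1ℚ β) ℚ.* σ m
  2k∂k m β = trans (∑-cong m (λ k → trans (cong (fromℕ (2 ℕ.* suc k) ℚ.*_) (trans (∂-affine (suc k) j i β)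
      (cong ℚ.-_ (constᶜ-scale (i (suc k)) β)))) (rearr (fromℕ (2 ℕ.* suc k)) (i (suc k)) (constᶜ 1ℚ β))))
    (∑-* m (ℚ.- constᶜ 1ℚ β) (λ k → fromℕ (2 ℕ.* suc k) ℚ.* i (suc k)))
    where
    rearr : ∀ w v e → w ℚ.* (ℚ.- (v ℚ.* e)) ≡ (ℚ.- e) ℚ.* (w ℚ.* v)
    rearr = solve-∀ ℚ-ring
  summand : ∀ ℓ β →
    (ℚ.- (fromℕ ℓ ℚ.* coeff (∂ ℓ (affine j i)) β)
      ℚ.+ ∑[ k < ℓ ] coeff (fromℕ (2 ℕ.* suc k) • ∂ (suc k) (affine j i)) β)
      ℚ.- ∑[ k < b ] coeff (fromℕ (2 ℕ.* suc k) • ∂ (suc k) (affine j i)) β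
    ≡ constᶜ (fromℕ ℓ ℚ.* i ℓ ℚ.- σ ℓ ℚ.+ σ b) β
  summand ℓ β = begin
    _ ≡⟨ cong₂ ℚ._-_ (cong₂ (λ x y → ℚ.- (fromℕ ℓ ℚ.* x) ℚ.+ y)
           (trans (∂-affine ℓ j i β) (cong ℚ.-_ (constᶜ-scale (i ℓ) β))) (2k∂k ℓ β)) (2k∂k b β) ⟩
    (ℚ.- (fromℕ ℓ ℚ.* (ℚ.- (i ℓ ℚ.* e))) ℚ.+ (ℚ.- e) ℚ.* σ ℓ) ℚ.- (ℚ.- e) ℚ.* σ b
      ≡⟨ rearr (fromℕ ℓ) (i ℓ) e (σ ℓ) (σ b) ⟩
    (fromℕ ℓ ℚ.* i ℓ ℚ.- σ ℓ ℚ.+ σ b) ℚ.* e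
      ≡⟨ constᶜ-scale _ β ⟨
    constᶜ (fromℕ ℓ ℚ.* i ℓ ℚ.- σ ℓ ℚ.+ σ b) β
      ∎
    where
    e = constᶜ 1ℚ β
    rearr : ∀ l v e s t → (ℚ.- (l ℚ.* (ℚ.- (v ℚ.* e))) ℚ.+ (ℚ.- e) ℚ.* s) ℚ.- (ℚ.- e) ℚ.* t ≡ (l ℚ.* v ℚ.- s ℚ.+ t) ℚ.* e
    rearr = solve-∀ ℚ-ring

Dstr-Ž : ∀ b n → Dstr b (Ž b n) ≈
  (ℚ.- fromℕ (suc n)) • Ž b (suc n) + (fromℕ b ℚ.- fromℕ n) • Ž b n
Dstr-Ž b n α = begin
  coeff (Dstr b (Ž b n)) α
    ≡⟨ Dstr-affine b (J b n) (λ ℓ → I b ℓ n) α ⟩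
  coeff (affine (ℚ.- I b 1 n) (λ ℓ → fromℕ ℓ ℚ.* I b ℓ n ℚ.- σ ℓ ℚ.+ σ b)) α
    ≡⟨ affine-cong
         (alg₁ M N B (J b (suc n)) (J b n) (I b 1 n) (J-equation b n))
         (λ ℓ → alg₂ M N B (I b ℓ (suc n)) (I b ℓ n) (fromℕ ℓ) (σ ℓ) (σ b) (I-equation b ℓ n)) α ⟩
  coeff (affine ((ℚ.- M) ℚ.* J b (suc n) ℚ.+ (B ℚ.- N) ℚ.* J b n)
                (λ ℓ → (ℚ.- M) ℚ.* I b ℓ (suc n) ℚ.+ (B ℚ.- N) ℚ.* I b ℓ n)) α
    ≡⟨ affine-linear (ℚ.- M) (B ℚ.- N) (J b (suc n)) (J b n) (λ ℓ → I b ℓ (suc n)) (λ ℓ → I b ℓ n) α ⟩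
  coeff ((ℚ.- M) • Ž b (suc n) + (B ℚ.- N) • Ž b n) α
    ∎
  where
  open ≡-Reasoning
  M = fromℕ (suc n)
  N = fromℕ n
  B = fromℕ b
  σ : ℕ → ℚ
  σ m = ∑[ k < m ] (fromℕ (2 ℕ.* suc k) ℚ.* I b (suc k) n)
  alg₁ : ∀ m n c x y z → m ℚ.* x ℚ.+ n ℚ.* y ≡ c ℚ.* y ℚ.+ z → ℚ.- z ≡ (ℚ.- m) ℚ.* x ℚ.+ (c ℚ.- n) ℚ.* y
  alg₁ m n c x y z eq = trans (p c y z) (trans (cong (λ w → c ℚ.* y ℚ.- w) (sym eq)) (q m n c x y))
    where
    p : ∀ c y z → ℚ.- z ≡ c ℚ.* y ℚ.- (c ℚ.* y ℚ.+ z)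
    p = solve-∀ ℚ-ring
    q : ∀ m n c x y → c ℚ.* y ℚ.- (m ℚ.* x ℚ.+ n ℚ.* y) ≡ (ℚ.- m) ℚ.* x ℚ.+ (c ℚ.- n) ℚ.* y
    q = solve-∀ ℚ-ring
  alg₂ : ∀ m n c x y l s t → (m ℚ.* x ℚ.+ n ℚ.* y) ℚ.- c ℚ.* y ≡ s ℚ.- l ℚ.* y ℚ.- t →
    l ℚ.* y ℚ.- s ℚ.+ t ≡ (ℚ.- m) ℚ.* x ℚ.+ (c ℚ.- n) ℚ.* y
  alg₂ m n c x y l s t eq = trans (p l y s t) (trans (cong ℚ.-_ (sym eq)) (q m n c x y))
    where
    p : ∀ l y s t → l ℚ.* y ℚ.- s ℚ.+ t ≡ ℚ.- (s ℚ.- l ℚ.* y ℚ.- t)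
    p = solve-∀ ℚ-ring
    q : ∀ m n c x y → ℚ.- ((m ℚ.* x ℚ.+ n ℚ.* y) ℚ.- c ℚ.* y) ≡ (ℚ.- m) ℚ.* x ℚ.+ (c ℚ.- n) ℚ.* y
    q = solve-∀ ℚ-ring

Ddil-Ž : ∀ b n → Ddil (Ž b n) ≈ - Ž b n
Ddil-Ž b n α = begin
  coeff (Ddil (Ž b n)) α
    ≡⟨ cong₂ ℚ._-_
         (cong₂ ℚ._-_ (trans (∂-affine 1 j i α) (cong ℚ.-_ (constᶜ-scale (i 1) α)))
                      (trans (∂-affine 0 j i α) (cong ℚ.-_ (constᶜ-scale (i 0) α))))
         (trans (∑x·ᶜ-cong α (λ ℓ β _ → trans (∂-affine ℓ j i β) (-1* (constᶜ (i ℓ) β))))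
                (∑x·ᶜ-* (ℚ.- 1ℚ) (λ ℓ → constᶜ (i ℓ)) α)) ⟩
  (ℚ.- (i 1 ℚ.* e) ℚ.- ℚ.- (i 0 ℚ.* e)) ℚ.- (ℚ.- 1ℚ) ℚ.* X
    ≡⟨ rearr (i 1) (i 0) e X ⟩
  ℚ.- ((i 1 ℚ.- i 0) ℚ.* e ℚ.- X)
    ≡⟨ cong (λ x → ℚ.- (x ℚ.- X)) (trans (constᶜ-scale j α) (cong (ℚ._* e) (J≡I₁-I₀ b n))) ⟨
  ℚ.- (constᶜ j α ℚ.- X)
    ∎
  where
  open ≡-Reasoning
  j = J b n
  i : ℕ → ℚ
  i ℓ = I b ℓ n
  e = constᶜ 1ℚ α
  X = ∑x·ᶜ (λ ℓ → constᶜ (i ℓ)) α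
  -1* : ∀ x → ℚ.- x ≡ (ℚ.- 1ℚ) ℚ.* x
  -1* = solve-∀ ℚ-ring
  rearr : ∀ x y e X → (ℚ.- (x ℚ.* e) ℚ.- ℚ.- (y ℚ.* e)) ℚ.- (ℚ.- 1ℚ) ℚ.* X ≡ ℚ.- ((x ℚ.- y) ℚ.* e ℚ.- X)
  rearr = solve-∀ ℚ-ring

-- From Ž to M̌

θ-linear : ∀ c d f g n → θ (λ m → c ℚ.* f m ℚ.+ d ℚ.* g m) n ≡ c ℚ.* θ f n ℚ.+ d ℚ.* θ g n
θ-linear c d f g n = rearr (fromℕ (suc n)) (fromℕ n) c d (f (suc n)) (f n) (g (suc n)) (g n)
  where
  rearr : ∀ m n c d x y z w →
    m ℚ.* (c ℚ.* x ℚ.+ d ℚ.* z) ℚ.+ n ℚ.* (c ℚ.* y ℚ.+ d ℚ.* w)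
    ≡ c ℚ.* (m ℚ.* x ℚ.+ n ℚ.* y) ℚ.+ d ℚ.* (m ℚ.* z ℚ.+ n ℚ.* w)
  rearr = solve-∀ ℚ-ring

θ-cong : ∀ {f g : ℕ → ℚ} → (∀ m → f m ≡ g m) → ∀ n → θ f n ≡ θ g n
θ-cong f≡g n = cong₂ (λ x y → fromℕ (suc n) ℚ.* x ℚ.+ fromℕ n ℚ.* y) (f≡g (suc n)) (f≡g n)

Θ : FPS[[r]] → FPS[[r]]
Θ F = [1+r]· (∂ᵣ F)

Θ-coeff : ∀ F n α → coeff (Θ F n) α ≡ θ (λ m → coeff (F m) α) n
Θ-coeff F zero    α = sym (trans (cong (1ℚ ℚ.* coeff (F 1) α ℚ.+_) (ℚ.*-zeroˡ (coeff (F 0) α))) (ℚ.+-identityʳ _))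
Θ-coeff F (suc n) α = refl

shift : (ℕ → ℚ) → ℕ → ℚ
shift f zero    = f zero
shift f (suc n) = f (suc n) ℚ.+ f n

-- (1 + r)∂ᵣ (1 + r) = (1 + r) ((1 + r)∂ᵣ + 1), hence each factor
-- (1 + r)⁻¹ raises c by s.
shift-cancel : ∀ s c {f g} →
  (∀ n → shift f n ≡ s ℚ.* θ (shift g) n ℚ.+ c ℚ.* shift g n) →
  ∀ n → f n ≡ s ℚ.* θ g n ℚ.+ (c ℚ.+ s) ℚ.* g n
shift-cancel s c {f} {g} eq zero = trans (eq 0) (rearr s c (g 0) (g 1))
  where
  rearr : ∀ s c x y → s ℚ.* (1ℚ ℚ.* (y ℚ.+ x) ℚ.+ 0ℚ ℚ.* x) ℚ.+ c ℚ.* x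
        ≡ s ℚ.* (1ℚ ℚ.* y ℚ.+ 0ℚ ℚ.* x) ℚ.+ (c ℚ.+ s) ℚ.* x
  rearr = solve-∀ ℚ-ring
shift-cancel s c {f} {g} eq (suc n) = begin
  f (suc n)
    ≡⟨ add-sub (f (suc n)) (f n) ⟩
  shift f (suc n) ℚ.- f n
    ≡⟨ cong₂ ℚ._-_ (eq (suc n)) (shift-cancel s c {f} {g} eq n) ⟩
  (s ℚ.* θ (shift g) (suc n) ℚ.+ c ℚ.* shift g (suc n)) ℚ.- (s ℚ.* θ g n ℚ.+ (c ℚ.+ s) ℚ.* g n)
    ≡⟨ alg s c N M₁ M₂ (g n) (g (suc n)) (g (suc (suc n))) (fromℕ-suc n) (fromℕ-suc (suc n)) ⟩
  s ℚ.* θ g (suc n) ℚ.+ (c ℚ.+ s) ℚ.* g (suc n)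
    ∎
  where
  open ≡-Reasoning
  N = fromℕ n
  M₁ = fromℕ (suc n)
  M₂ = fromℕ (suc (suc n))
  add-sub : ∀ x y → x ≡ (x ℚ.+ y) ℚ.- y
  add-sub = solve-∀ ℚ-ring
  poly : ∀ s c n x y z →
    (s ℚ.* ((1ℚ ℚ.+ (1ℚ ℚ.+ n)) ℚ.* (z ℚ.+ y) ℚ.+ (1ℚ ℚ.+ n) ℚ.* (y ℚ.+ x)) ℚ.+ c ℚ.* (y ℚ.+ x))
      ℚ.- (s ℚ.* ((1ℚ ℚ.+ n) ℚ.* y ℚ.+ n ℚ.* x) ℚ.+ (c ℚ.+ s) ℚ.* x)
    ≡ s ℚ.* ((1ℚ ℚ.+ (1ℚ ℚ.+ n)) ℚ.* z ℚ.+ (1ℚ ℚ.+ n) ℚ.* y) ℚ.+ (c ℚ.+ s) ℚ.* y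
  poly = solve-∀ ℚ-ring
  alg : ∀ s c n m₁ m₂ x y z → m₁ ≡ 1ℚ ℚ.+ n → m₂ ≡ 1ℚ ℚ.+ m₁ →
    (s ℚ.* (m₂ ℚ.* (z ℚ.+ y) ℚ.+ m₁ ℚ.* (y ℚ.+ x)) ℚ.+ c ℚ.* (y ℚ.+ x))
      ℚ.- (s ℚ.* (m₁ ℚ.* y ℚ.+ n ℚ.* x) ℚ.+ (c ℚ.+ s) ℚ.* x)
    ≡ s ℚ.* (m₂ ℚ.* z ℚ.+ m₁ ℚ.* y) ℚ.+ (c ℚ.+ s) ℚ.* y
  alg s c n _ _ x y z refl refl = poly s c n x y z

[1+r]·-coeff : ∀ F n α → coeff ([1+r]· F n) α ≡ shift (λ m → coeff (F m) α) n
[1+r]·-coeff F zero    α = refl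
[1+r]·-coeff F (suc n) α = refl

module _ (D : FPS → FPS) (d : IsDerivation (λ F → coeff (D F))) (s : ℚ) where

  ActsAs : ℚ → FPS[[r]] → Set
  ActsAs c F = ∀ n → D (F n) ≈ s • Θ F n + c • F n

  D-[1+r]· : ∀ F n → D ([1+r]· F n) ≈ [1+r]· (λ m → D (F m)) n
  D-[1+r]· F zero    α = refl
  D-[1+r]· F (suc n) α = +-homo d (F (suc n)) (F n) α

  D-Θ : ∀ F n → D (Θ F n) ≈ Θ (λ m → D (F m)) n
  D-Θ F n α = trans (D-[1+r]· (∂ᵣ F) n α)
    (trans ([1+r]·-coeff (λ m → D (∂ᵣ F m)) n α)
    (trans (shift-cong (λ m → •-homo d (fromℕ (suc m)) (F (suc m)) α) n)
           (sym ([1+r]·-coeff (∂ᵣ (λ m → D (F m))) n α))))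
    where
    shift-cong : ∀ {f g : ℕ → ℚ} → (∀ m → f m ≡ g m) → ∀ n → shift f n ≡ shift g n
    shift-cong f≡g zero    = f≡g 0
    shift-cong f≡g (suc n) = cong₂ ℚ._+_ (f≡g (suc n)) (f≡g n)

  ActsAs-coeff : ∀ c F → ActsAs c F → ∀ n α →
    coeff (D (F n)) α ≡ s ℚ.* θ (λ m → coeff (F m) α) n ℚ.+ c ℚ.* coeff (F n) α
  ActsAs-coeff c F acts n α = trans (acts n α) (cong (λ x → s ℚ.* x ℚ.+ c ℚ.* coeff (F n) α) (Θ-coeff F n α))

  ActsAs-[1+r]⁻¹· : ∀ c F → ActsAs c F → ActsAs (c ℚ.+ s) ([1+r]⁻¹· F)
  ActsAs-[1+r]⁻¹· c F acts n α = trans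
    (shift-cancel s c {λ m → coeff (D (G m)) α} {λ m → coeff (G m) α} shifted n)
    (cong (λ x → s ℚ.* x ℚ.+ (c ℚ.+ s) ℚ.* coeff (G n) α) (sym (Θ-coeff G n α)))
    where
    open ≡-Reasoning
    G = [1+r]⁻¹· F
    F-coeff : ∀ m → coeff (F m) α ≡ shift (λ m → coeff (G m) α) m
    F-coeff m = trans (sym ([1+r]-inverse F m α)) ([1+r]·-coeff G m α)
    shifted : ∀ m → shift (λ m → coeff (D (G m)) α) m
      ≡ s ℚ.* θ (shift (λ m → coeff (G m) α)) m ℚ.+ c ℚ.* shift (λ m → coeff (G m) α) m
    shifted m = begin
      shift (λ m → coeff (D (G m)) α) m        ≡⟨ [1+r]·-coeff (λ m → D (G m)) m α ⟨
      coeff ([1+r]· (λ m → D (G m)) m) α       ≡⟨ D-[1+r]· G m α ⟨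
      coeff (D ([1+r]· G m)) α
        ≡⟨ D-cong D d {[1+r]· G m} {F m} ([1+r]-inverse F m) α ⟩
      coeff (D (F m)) α                        ≡⟨ ActsAs-coeff c F acts m α ⟩
      s ℚ.* θ (λ m → coeff (F m) α) m ℚ.+ c ℚ.* coeff (F m) α
                                               ≡⟨ cong₂ (λ x y → s ℚ.* x ℚ.+ c ℚ.* y) (θ-cong F-coeff m) (F-coeff m) ⟩
      s ℚ.* θ (shift (λ m → coeff (G m) α)) m ℚ.+ c ℚ.* shift (λ m → coeff (G m) α) m ∎

  ActsAs-[1+r]^- : ∀ k c F → ActsAs c F → ActsAs (c ℚ.+ fromℕ k ℚ.* s) ([1+r]^- k · F)
  ActsAs-[1+r]^- zero    c F acts = subst (λ c → ActsAs c F)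
    (sym (trans (cong (c ℚ.+_) (ℚ.*-zeroˡ s)) (ℚ.+-identityʳ c))) acts
  ActsAs-[1+r]^- (suc k) c F acts = subst (λ c → ActsAs c ([1+r]^- suc k · F))
    (trans (rearr c (fromℕ k) s) (cong (λ x → c ℚ.+ x ℚ.* s) (sym (fromℕ-suc k))))
    (ActsAs-[1+r]⁻¹· (c ℚ.+ fromℕ k ℚ.* s) ([1+r]^- k · F) (ActsAs-[1+r]^- k c F acts))
    where
    rearr : ∀ c k s → c ℚ.+ k ℚ.* s ℚ.+ s ≡ c ℚ.+ (1ℚ ℚ.+ k) ℚ.* s
    rearr = solve-∀ ℚ-ring

  ActsAs-Θ : ∀ c F → ActsAs c F → ActsAs c (Θ F)
  ActsAs-Θ c F acts n α = begin
    coeff (D (Θ F n)) α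
      ≡⟨ D-Θ F n α ⟩
    coeff (Θ (λ m → D (F m)) n) α
      ≡⟨ Θ-coeff (λ m → D (F m)) n α ⟩
    θ (λ m → coeff (D (F m)) α) n
      ≡⟨ θ-cong (λ m → acts m α) n ⟩
    θ (λ m → s ℚ.* coeff (Θ F m) α ℚ.+ c ℚ.* coeff (F m) α) n
      ≡⟨ θ-linear s c (λ m → coeff (Θ F m) α) (λ m → coeff (F m) α) n ⟩
    s ℚ.* θ (λ m → coeff (Θ F m) α) n ℚ.+ c ℚ.* θ (λ m → coeff (F m) α) n
      ≡⟨ cong₂ (λ x y → s ℚ.* x ℚ.+ c ℚ.* y) (Θ-coeff (Θ F) n α) (Θ-coeff F n α) ⟨
    s ℚ.* coeff (Θ (Θ F) n) α ℚ.+ c ℚ.* coeff (Θ F n) α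
      ∎
    where open ≡-Reasoning

  ActsAs-evalOp : ∀ q c F → ActsAs c F → ActsAs c (evalOp q Θ F)
  ActsAs-evalOp [] c F acts n α = trans (D-0# D d α) (trans (constᶜ-0 α) (sym (begin
    s ℚ.* coeff (Θ (λ _ → 0#) n) α ℚ.+ c ℚ.* constᶜ 0ℚ α
      ≡⟨ cong₂ (λ x y → s ℚ.* x ℚ.+ c ℚ.* y)
           (trans (Θ-coeff (λ _ → 0#) n α) (θ-cong (λ _ → constᶜ-0 α) n)) (constᶜ-0 α) ⟩
    s ℚ.* (fromℕ (suc n) ℚ.* 0ℚ ℚ.+ fromℕ n ℚ.* 0ℚ) ℚ.+ c ℚ.* 0ℚ
      ≡⟨ vanish s (fromℕ (suc n)) (fromℕ n) c ⟩
    0ℚ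
      ∎)))
    where
    open ≡-Reasoning
    vanish : ∀ s m n c → s ℚ.* (m ℚ.* 0ℚ ℚ.+ n ℚ.* 0ℚ) ℚ.+ c ℚ.* 0ℚ ≡ 0ℚ
    vanish = solve-∀ ℚ-ring
  ActsAs-evalOp (a ∷ q) c F acts n α = begin
    coeff (D (a • F n + G n)) α
      ≡⟨ trans (+-homo d (a • F n) (G n) α) (cong (ℚ._+ coeff (D (G n)) α) (•-homo d a (F n) α)) ⟩
    a ℚ.* coeff (D (F n)) α ℚ.+ coeff (D (G n)) α
      ≡⟨ cong₂ (λ x y → a ℚ.* x ℚ.+ y) (ActsAs-coeff c F acts n α)
           (ActsAs-coeff c G (ActsAs-evalOp q c (Θ F) (ActsAs-Θ c F acts)) n α) ⟩
    a ℚ.* (s ℚ.* θ f n ℚ.+ c ℚ.* f n) ℚ.+ (s ℚ.* θ g n ℚ.+ c ℚ.* g n)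
      ≡⟨ rearr a s c (fromℕ (suc n)) (fromℕ n) (f (suc n)) (f n) (g (suc n)) (g n) ⟩
    s ℚ.* θ (λ m → a ℚ.* f m ℚ.+ g m) n ℚ.+ c ℚ.* (a ℚ.* f n ℚ.+ g n)
      ≡⟨ cong (λ x → s ℚ.* x ℚ.+ c ℚ.* (a ℚ.* f n ℚ.+ g n)) (Θ-coeff (evalOp (a ∷ q) Θ F) n α) ⟨
    coeff (s • Θ (evalOp (a ∷ q) Θ F) n + c • evalOp (a ∷ q) Θ F n) α
      ∎
    where
    open ≡-Reasoning
    G = evalOp q Θ (Θ F)
    f g : ℕ → ℚ
    f m = coeff (F m) α
    g m = coeff (G m) α
    rearr : ∀ a s c m n x y z w →
      a ℚ.* (s ℚ.* (m ℚ.* x ℚ.+ n ℚ.* y) ℚ.+ c ℚ.* y) ℚ.+ (s ℚ.* (m ℚ.* z ℚ.+ n ℚ.* w) ℚ.+ c ℚ.* w)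
      ≡ s ℚ.* (m ℚ.* (a ℚ.* x ℚ.+ z) ℚ.+ n ℚ.* (a ℚ.* y ℚ.+ w)) ℚ.+ c ℚ.* (a ℚ.* y ℚ.+ w)
    rearr = solve-∀ ℚ-ring

  D-∣r= : ∀ c F {R} → coeff R [] ≡ 0ℚ → ActsAs c F →
    D (F ∣r= R) ≈ ∂ᵣ F ∣r= R * (D R + s • (1# + R)) + c • F ∣r= R
  D-∣r= c F {R} R[]≡0 acts α = begin
    coeff (D (F ∣r= R)) α
      ≡⟨ chain-rule D d F R[]≡0 α ⟩
    coeff ((λ n → D (F n)) ∣r= R) α ℚ.+ coeff (A * D R) α
      ≡⟨ cong (ℚ._+ coeff (A * D R) α) (trans
           (∣r=-cong {λ n → D (F n)} {λ n → s • Θ F n + c • F n} R acts α)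
           (trans (∣r=-+ (λ n → s • Θ F n) (λ n → c • F n) R α)
                  (cong₂ ℚ._+_ (∣r=-• s (Θ F) R α) (∣r=-• c F R α)))) ⟩
    (s ℚ.* coeff (Θ F ∣r= R) α ℚ.+ c ℚ.* coeff (F ∣r= R) α) ℚ.+ coeff (A * D R) α
      ≡⟨ cong (λ x → (s ℚ.* x ℚ.+ c ℚ.* coeff (F ∣r= R) α) ℚ.+ coeff (A * D R) α)
           (trans (∣r=-[1+r]· (∂ᵣ F) R[]≡0 α) (mulᶜ-comm (coeff (1# + R)) (coeff A) α)) ⟩
    (s ℚ.* coeff (A * (1# + R)) α ℚ.+ c ℚ.* coeff (F ∣r= R) α) ℚ.+ coeff (A * D R) α
      ≡⟨ rearr (s ℚ.* coeff (A * (1# + R)) α) (c ℚ.* coeff (F ∣r= R) α) (coeff (A * D R) α) ⟩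
    (coeff (A * D R) α ℚ.+ s ℚ.* coeff (A * (1# + R)) α) ℚ.+ c ℚ.* coeff (F ∣r= R) α
      ≡⟨ cong (ℚ._+ c ℚ.* coeff (F ∣r= R) α) (trans
           (mulᶜ-+ʳ (coeff A) (coeff (D R)) (coeff (s • (1# + R))) α)
           (cong (coeff (A * D R) α ℚ.+_) (mulᶜ-*ʳ s (coeff A) (coeff (1# + R)) α))) ⟨
    coeff (A * (D R + s • (1# + R)) + c • F ∣r= R) α
      ∎
    where
    open ≡-Reasoning
    A = ∂ᵣ F ∣r= R
    rearr : ∀ x y z → (x ℚ.+ y) ℚ.+ z ≡ (z ℚ.+ x) ℚ.+ y
    rearr = solve-∀ ℚ-ring

  D-root : ∀ c b {R} → IsŘ b R → ActsAs c (Ž b) → D R + s • (1# + R) ≈ 0#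
  D-root c b {R} (R[]≡0 , Ž≈0) acts = *-cancel-unit A (D R + s • (1# + R)) refl λ α → begin
    coeff (A * (D R + s • (1# + R))) α
      ≡⟨ drop (coeff (A * (D R + s • (1# + R))) α) c (trans (Ž≈0 α) (constᶜ-0 α)) ⟨
    coeff (A * (D R + s • (1# + R)) + c • Ž b ∣r= R) α
      ≡⟨ D-∣r= c (Ž b) R[]≡0 acts α ⟨
    coeff (D (Ž b ∣r= R)) α
      ≡⟨ D-cong D d {Ž b ∣r= R} {0#} Ž≈0 α ⟩
    coeff (D 0#) α
      ≡⟨ D-0# D d α ⟩
    constᶜ 0ℚ α
      ∎
    where
    open ≡-Reasoning
    A = ∂ᵣ (Ž b) ∣r= R
    drop : ∀ x c {z} → z ≡ 0ℚ → x ℚ.+ c ℚ.* z ≡ x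
    drop x c refl = trans (cong (x ℚ.+_) (ℚ.*-zeroʳ c)) (ℚ.+-identityʳ x)

  D-M̌ : ∀ c Q b R → IsŘ b R → ActsAs c (Ž b) → D (M̌ Q b R) ≈ (c ℚ.+ fromℕ b ℚ.* s) • M̌ Q b R
  D-M̌ c Q b R isŘ acts α = begin
    coeff (D (H ∣r= R)) α
      ≡⟨ D-∣r= c′ H (proj₁ isŘ) (ActsAs-evalOp (at Q (fromℕ b)) c′ ([1+r]^- b · (Ž b)) (ActsAs-[1+r]^- b c (Ž b) acts)) α ⟩
    coeff (A * (D R + s • (1# + R))) α ℚ.+ c′ ℚ.* coeff (H ∣r= R) α
      ≡⟨ cong (ℚ._+ c′ ℚ.* coeff (H ∣r= R) α) (trans
           (mulᶜ-congʳ (coeff A) α (D-root c b isŘ acts))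
           (trans (zeroʳ A α) (constᶜ-0 α))) ⟩
    0ℚ ℚ.+ c′ ℚ.* coeff (H ∣r= R) α
      ≡⟨ ℚ.+-identityˡ _ ⟩
    c′ ℚ.* coeff (H ∣r= R) α
      ∎
    where
    open ≡-Reasoning
    H = evalOp (at Q (fromℕ b)) Θ ([1+r]^- b · (Ž b))
    A = ∂ᵣ H ∣r= R
    c′ = c ℚ.+ fromℕ b ℚ.* s

lemma20 : (p b : ℕ) (Q : Poly₂) → IsQ p Q → (R : FPS) → IsŘ b R →
          (Dstr b (M̌ Q b R) ≈ 0#) × (Ddil (M̌ Q b R) ≈ - M̌ Q b R)
lemma20 p b Q _ R isŘ = str , dil
  where
  str : Dstr b (M̌ Q b R) ≈ 0#
  str α = trans (D-M̌ (Dstr b) (Dstr-isDerivation b) (ℚ.- 1ℚ) (fromℕ b) Q b R isŘ acts α)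
    (trans (vanish (fromℕ b) (coeff (M̌ Q b R) α)) (sym (constᶜ-0 α)))
    where
    vanish : ∀ x y → (x ℚ.+ x ℚ.* (ℚ.- 1ℚ)) ℚ.* y ≡ 0ℚ
    vanish = solve-∀ ℚ-ring
    rearr : ∀ m n c x y → (ℚ.- m) ℚ.* x ℚ.+ (c ℚ.- n) ℚ.* y ≡ (ℚ.- 1ℚ) ℚ.* (m ℚ.* x ℚ.+ n ℚ.* y) ℚ.+ c ℚ.* y
    rearr = solve-∀ ℚ-ring
    acts : ∀ n → Dstr b (Ž b n) ≈ (ℚ.- 1ℚ) • Θ (Ž b) n + fromℕ b • Ž b n
    acts n α = trans (Dstr-Ž b n α) (trans
      (rearr (fromℕ (suc n)) (fromℕ n) (fromℕ b) (coeff (Ž b (suc n)) α) (coeff (Ž b n) α))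
      (cong (λ x → (ℚ.- 1ℚ) ℚ.* x ℚ.+ fromℕ b ℚ.* coeff (Ž b n) α) (sym (Θ-coeff (Ž b) n α))))
  dil : Ddil (M̌ Q b R) ≈ - M̌ Q b R
  dil α = trans (D-M̌ Ddil Ddil-isDerivation 0ℚ (ℚ.- 1ℚ) Q b R isŘ acts α) (simplify (fromℕ b) (coeff (M̌ Q b R) α))
    where
    simplify : ∀ x y → ((ℚ.- 1ℚ) ℚ.+ x ℚ.* 0ℚ) ℚ.* y ≡ ℚ.- y
    simplify = solve-∀ ℚ-ring
    rearr : ∀ x y → ℚ.- y ≡ 0ℚ ℚ.* x ℚ.+ (ℚ.- 1ℚ) ℚ.* y
    rearr = solve-∀ ℚ-ring
    acts : ∀ n → Ddil (Ž b n) ≈ 0ℚ • Θ (Ž b) n + (ℚ.- 1ℚ) • Ž b n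
    acts n α = trans (Ddil-Ž b n α) (rearr (coeff (Θ (Ž b) n) α) (coeff (Ž b n) α))
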